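{- Let $q$ be a power of a prime. For any integer $b \ge 2$, the de Bruijn graph $G_{det}$ of the determinant function $det:\mathbb{F}_q^{2b-1}\to\mathbb{F}_q$ is $(q-1)q^{b-1}$-regular, i.e. every vertex has indegree and outdegree equal to $(q-1)q^{b-1}$.
   Context: $\mathbb{F}_q$ is the finite field with $q$ elements. Determinant function: for $a=(a_2,\ldots,a_{2b})\in\mathbb{F}_q^{2b-1}$ let $M_a$ be the $b\times b$ Toeplitz matrix whose $(r,c)$ entry is $a_{b+1+c-r}$ (first row $a_{b+1},\ldots,a_{2b}$; last row $a_2,\ldots,a_{b+1}$), and let $det(a)$ be the determinant of $M_a$. Its support is $supp(det)=\{a\in\mathbb{F}_q^{2b-1}: det(a)\ne 0\}$. De Bruijn graph: for words $u,v$ over an alphabet $A$ of length at least $s$, the $s$-fusion $u\odot v = z$ holds if and only if there exist $x\in A^s$ and words $u_0,v_0$ with $u=u_0x$, $v=xv_0$, $z=u_0xv_0$. $G_{det}=(V,E)$ is the directed graph (loops allowed) with $V=supp(det)$ and $(v_1,v_2)\in E$ if and only if there exists $z\in\mathbb{F}_q^{3b-1}$ with $z=v_1\odot v_2$, where $s=b-1$; i.e. the last $b-1$ coordinates of $v_1$ coincide with the first $b-1$ coordinates of $v_2$. A loop contributes one to the indegree and one to the outdegree of its vertex. -}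

module Defs where

open import Algebra.Apartness.Bundles using (HeytingField; HeytingCommutativeRing)
open import Algebra.Bundles using (CommutativeRing; Semiring)
import Algebra.Definitions.RawSemiring as RawSemiringDefs
open import Data.Fin.Base using (Fin; zero; suc; toℕ; fromℕ<; punchIn)
open import Data.Fin.Properties using (toℕ<n)
open import Data.Nat.Base using (ℕ; zero; suc; _+_; _*_; _∸_; _^_; _<_)
open import Data.Nat.Primality using (Prime)
open import Data.Nat.Properties
  using (≤-<-trans; m∸n≤m; +-monoʳ-<; +-identityʳ)
open import Data.Product.Base using (Σ-syntax; ∃₂; ∃-syntax; _×_; _,_; proj₁)
open import Data.Vec.Base using (Vec; _++_; lookup)
import Data.Vec.Relation.Binary.Equality.Setoid as VecEquality
open import Function.Bundles using (Inverse)
open import Level using (Level; _⊔_) renaming (suc to lsuc)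
open import Relation.Binary.Bundles using (Setoid)
import Relation.Binary.Construct.On as On
open import Relation.Binary.Core using (Rel)
open import Relation.Binary.Definitions using (_Respects₂_)
open import Relation.Binary.PropositionalEquality as ≡ using (_≡_)
open import Relation.Nullary.Negation using (¬_)

private variable
  a c ℓ ℓ₁ ℓ₂ e : Level

HasSize : Setoid a ℓ → ℕ → Set (a ⊔ ℓ)
HasSize S n = Inverse (≡.setoid (Fin n)) S

IsPrimePower : ℕ → Set
IsPrimePower q = ∃₂ λ p k → Prime p × q ≡ p ^ suc k

-- For a finite setoid the apartness of a Heyting field coincides with the
-- negation of its equality, so a Heyting field that has q elements is a
-- field with q elements in the classical sense.
fieldRing : HeytingField c ℓ₁ ℓ₂ → CommutativeRing c ℓ₁
fieldRing F =
  HeytingCommutativeRing.commutativeRing (HeytingField.heytingCommutativeRing F)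

-- Neighbours are identified when they are equal as vertices, whatever the
-- proofs of adjacency; a loop at v makes v both an in- and an out-neighbour.
record Digraph (a ℓ e : Level) : Set (lsuc (a ⊔ ℓ ⊔ e)) where
  field
    vertices : Setoid a ℓ
  open Setoid vertices public using () renaming (Carrier to Vertex; _≈_ to _≈ᵥ_)
  field
    Edge      : Rel Vertex e
    Edge-resp : Edge Respects₂ _≈ᵥ_

  outNeighbours : Vertex → Setoid (a ⊔ e) ℓ
  outNeighbours v = On.setoid {B = Σ[ w ∈ Vertex ] Edge v w} vertices proj₁

  inNeighbours : Vertex → Setoid (a ⊔ e) ℓ
  inNeighbours v = On.setoid {B = Σ[ u ∈ Vertex ] Edge u v} vertices proj₁

  HasOutdegree : Vertex → ℕ → Set (a ⊔ ℓ ⊔ e)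
  HasOutdegree v = HasSize (outNeighbours v)

  HasIndegree : Vertex → ℕ → Set (a ⊔ ℓ ⊔ e)
  HasIndegree v = HasSize (inNeighbours v)

  Regular : ℕ → Set (a ⊔ ℓ ⊔ e)
  Regular d = ∀ v → HasIndegree v d × HasOutdegree v d

module _ (A : Setoid a ℓ) where
  open Setoid A using (Carrier)
  open VecEquality A

  -- Fusion s u v z: the s-fusion of u and v is z.  The equality _≋_ of words
  -- relates vectors whose lengths need not be definitionally equal.
  Fusion : (s : ℕ) {k m n : ℕ} →
           Vec Carrier k → Vec Carrier m → Vec Carrier n → Set (a ⊔ ℓ)
  Fusion s u v z =
    Σ[ x ∈ Vec Carrier s ]
    ∃[ i ] Σ[ u₀ ∈ Vec Carrier i ]
    ∃[ j ] Σ[ v₀ ∈ Vec Carrier j ]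
      u ≋ u₀ ++ x × v ≋ x ++ v₀ × z ≋ u₀ ++ (x ++ v₀)

toeplitz-bound : ∀ b (r c : Fin b) → (b ∸ 1 + toℕ c) ∸ toℕ r < 2 * b ∸ 1
toeplitz-bound (suc n) r c rewrite +-identityʳ n =
  ≤-<-trans (m∸n≤m (n + toℕ c) (toℕ r)) (+-monoʳ-< n (toℕ<n c))

-- Positions of the vector and rows and columns of the matrix are counted
-- from 0: position i holds a_{i+2}, so the entry a_{b+1+c-r} for rows and
-- columns counted from 1 is at position (b - 1) + c - r.
toeplitz : {A : Set a} (b : ℕ) → Vec A (2 * b ∸ 1) → Fin b → Fin b → A
toeplitz b a r c = lookup a (fromℕ< (toeplitz-bound b r c))

module _ (R : CommutativeRing c ℓ) where
  open CommutativeRing R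
    using (Carrier; _≈_; 0#; 1#; -_; setoid; semiring)
    renaming (_*_ to _·_)
  open RawSemiringDefs (Semiring.rawSemiring semiring)
    using (sum) renaming (_^_ to _^ᴿ_)
  open VecEquality setoid

  -- Laplace expansion along the first row.
  determinant : (n : ℕ) → (Fin n → Fin n → Carrier) → Carrier
  determinant zero    M = 1#
  determinant (suc n) M = sum λ (j : Fin (suc n)) →
    (- 1#) ^ᴿ toℕ j · (M zero j · determinant n λ r k → M (suc r) (punchIn j k))

  det : (b : ℕ) → Vec Carrier (2 * b ∸ 1) → Carrier
  det b a = determinant b (toeplitz b a)

  supp-det : ℕ → Setoid (c ⊔ ℓ) (c ⊔ ℓ)
  supp-det b = On.setoid {B = Σ[ a ∈ Vec Carrier (2 * b ∸ 1) ] ¬ det b a ≈ 0#}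
    (≋-setoid (2 * b ∸ 1)) proj₁

  G-det : ℕ → Digraph (c ⊔ ℓ) (c ⊔ ℓ) (c ⊔ ℓ)
  G-det b = record
    { vertices  = supp-det b
    ; Edge      = λ (v₁ , _) (v₂ , _) →
                    Σ[ z ∈ Vec Carrier (3 * b ∸ 1) ] Fusion setoid (b ∸ 1) v₁ v₂ z
    ; Edge-resp =
        (λ eq (z , x , i , u₀ , j , v₀ , p , q , r) →
           z , x , i , u₀ , j , v₀ , p , ≋-trans (≋-sym eq) q , r)
      , (λ eq (z , x , i , u₀ , j , v₀ , p , q , r) →
           z , x , i , u₀ , j , v₀ , ≋-trans (≋-sym eq) p , q , r)
    }

{-# OPTIONS --safe #-}

-- Over a field a square matrix is nonsingular iff its kernel is trivial.  For
-- the Toeplitz matrix of a word h, read as a truncated power series, the kernel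
-- is trivial iff no polynomial p ≠ 0 of degree < m has a product p h whose
-- coefficients n, …, m + n - 1 all vanish (here m = b and n = b - 1).  For all
-- m ≥ 1 and n ≥ 0 and every choice of the first n coefficients, exactly
-- (q - 1) q^(m-1) series h modulo t^(m+n) have this property:
-- * if n = 0, it says that h(0) ≠ 0;
-- * if n ≥ m or h(0) = 0, h(0) plays no role, and replacing h by
--   (h - h(0)) / t takes n to n - 1;
-- * if n < m and h(0) ≠ 0, then (p , p h) ↦ (p h , p) exchanges h with 1/h and m
--   with n; the first n coefficients of 1/h are determined and the next m - n
--   are free, hence there are q^(m-n) (q - 1) q^(n-1) choices.
-- Out-neighbours are the words with a given prefix of length b - 1, and so are
-- in-neighbours after reversal, which transposes the matrix.
module Submission where

open import Defs
open import Algebra.Apartness.Bundles using (HeytingField)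
open import Algebra.Bundles using (CommutativeRing; Semiring)
import Algebra.Definitions.RawSemiring as RawSemiringDefs
import Algebra.Properties.Semiring.Sum as SemiringSum
import Algebra.Solver.Ring.NaturalCoefficients.Default as NaturalSolver
open import Data.Fin.Base
  using (Fin; zero; suc; toℕ; fromℕ<; opposite; combine; remQuot; punchIn; punchOut)
import Data.Fin.Permutation as Permutation
open import Data.Fin.Properties
  using (remQuot-combine; combine-remQuot; punchInᵢ≢i; punchIn-punchOut; punchOut-punchIn;
         punchOut-cong; opposite-prop; opposite-involutive; toℕ<n; toℕ-fromℕ<; any?)
  renaming (_≟_ to _≟ᶠ_)
open import Data.Nat.Base as ℕ using (ℕ; zero; suc; z≤n; s≤s; _≤_; _<_; _∸_; _^_)
open import Data.Nat.Induction using (Acc; acc; <-wellFounded)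
open import Data.Nat.Properties as ℕ using (_<?_)
open import Data.Nat.Solver using (module +-*-Solver)
open import Data.Product.Base using (Σ; ∃; _×_; _,_; proj₁)
open import Data.Sum.Base using (_⊎_; inj₁; inj₂)
open import Data.Vec.Base using (Vec; []; _∷_; _++_; lookup; map; tabulate)
open import Data.Vec.Properties using (lookup∘tabulate; tabulate-∘)
import Data.Vec.Relation.Binary.Equality.Setoid as VecEquality
open import Data.Vec.Relation.Unary.All using (All; []; _∷_)
import Data.Vec.Relation.Unary.All.Properties as All
open import Function.Base using (_∘_; id)
open import Function.Bundles using (Inverse)
open import Level using (_⊔_)
open import Relation.Binary.Bundles using (Setoid)
import Relation.Binary.Construct.On as On
open import Relation.Binary.Definitions using (Decidable)
open import Relation.Binary.PropositionalEquality as ≡ using (_≡_)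
import Relation.Binary.Reasoning.Setoid as SetoidReasoning
open import Relation.Nullary.Decidable using (yes; no; map′)
open import Relation.Nullary.Negation using (¬_; contradiction)

-- Finite setoids: subsets, bijections and counting by fibres.

Sub : ∀ {a ℓ p} (S : Setoid a ℓ) → (Setoid.Carrier S → Set p) → Setoid (a ⊔ p) ℓ
Sub S P = On.setoid {B = Σ (Setoid.Carrier S) P} S proj₁

module _ {a ℓ} {S : Setoid a ℓ} where
  open Setoid S

  mkSize : ∀ {n} (to : Fin n → Carrier) (from : Carrier → Fin n) →
           (∀ {x y} → x ≈ y → from x ≡ from y) →
           (∀ x → to (from x) ≈ x) → (∀ i → from (to i) ≡ i) → HasSize S n
  mkSize to from from-cong to-from from-to = record
    { to        = to
    ; from      = from
    ; to-cong   = λ { ≡.refl → refl }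
    ; from-cong = from-cong
    ; inverse   = (λ { ≡.refl → to-from _ }) ,
                  (λ {i} y≈ → ≡.trans (from-cong y≈) (from-to i))
    }

  module Enum {n : ℕ} (I : HasSize S n) where
    elt : Fin n → Carrier
    elt = Inverse.to I

    idx : Carrier → Fin n
    idx = Inverse.from I

    idx-cong : ∀ {x y} → x ≈ y → idx x ≡ idx y
    idx-cong = Inverse.from-cong I

    elt-idx : ∀ x → elt (idx x) ≈ x
    elt-idx x = Inverse.inverseˡ I ≡.refl

    idx-elt : ∀ i → idx (elt i) ≡ i
    idx-elt i = Inverse.inverseʳ I refl

    idx-injective : ∀ {x y} → idx x ≡ idx y → x ≈ y
    idx-injective {x} {y} eq =
      trans (sym (elt-idx x)) (trans (reflexive (≡.cong elt eq)) (elt-idx y))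

    ≈-dec : Decidable _≈_
    ≈-dec x y = map′ idx-injective idx-cong (idx x ≟ᶠ idx y)

module _ {a ℓ} {S : Setoid a ℓ} where
  open Setoid S

  -- For the index k of z, `punchIn k` runs through all the other indices; n is positive because z
  -- has an index.
  nonElement-size : ∀ {n} (z : Carrier) → HasSize S n → HasSize (Sub S λ x → ¬ x ≈ z) (n ∸ 1)
  nonElement-size {zero}  z I with () ← Inverse.from I z
  nonElement-size {suc n} z I = mkSize
    (λ i → elt (punchIn k i) ,
           λ eq → punchInᵢ≢i k i (≡.trans (≡.sym (idx-elt _)) (idx-cong eq)))
    (λ (x , x≉z) → punchOut (apart x≉z))
    (λ x≈y → punchOut-cong k (idx-cong x≈y))
    (λ (x , x≉z) → trans (reflexive (≡.cong elt (punchIn-punchOut (apart x≉z)))) (elt-idx x))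
    (λ i → ≡.trans (punchOut-cong k (idx-elt _)) (punchOut-punchIn k))
    where
    open Enum I
    k = idx z
    apart : ∀ {x} → ¬ x ≈ z → ¬ k ≡ idx x
    apart x≉z eq = x≉z (idx-injective (≡.sym eq))

module _ {a b ℓ ℓ′} {S : Setoid a ℓ} {T : Setoid b ℓ′} where
  private
    module S = Setoid S
    module T = Setoid T

  transfer : ∀ {n} (f : S.Carrier → T.Carrier) (g : T.Carrier → S.Carrier) →
             (∀ {x y} → x S.≈ y → f x T.≈ f y) → (∀ {x y} → x T.≈ y → g x S.≈ g y) →
             (∀ y → f (g y) T.≈ y) → (∀ x → g (f x) S.≈ x) →
             HasSize S n → HasSize T n
  transfer f g f-cong g-cong fg gf I = mkSize (f ∘ elt) (idx ∘ g)
    (idx-cong ∘ g-cong)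
    (λ y → T.trans (f-cong (elt-idx (g y))) (fg y))
    (λ i → ≡.trans (idx-cong (gf (elt i))) (idx-elt i))
    where open Enum I

  -- An element is numbered by the index of its image together with its index in that fibre. Fibres
  -- are taken over the enumerated representatives only.
  fibre-size : ∀ {k m} (f : S.Carrier → T.Carrier) →
               (∀ {x y} → x S.≈ y → f x T.≈ f y) → (I : HasSize T k) →
               (∀ i → HasSize (Sub S λ x → f x T.≈ Inverse.to I i) m) →
               HasSize S (k ℕ.* m)
  fibre-size {k} {m} f f-cong I J = mkSize (to ∘ remQuot m)
    (λ x → combine (idx (f x)) (from (idx (f x)) x (T.sym (elt-idx (f x)))))
    (λ x≈y → combine-cong (idx-cong (f-cong x≈y)) x≈y _ _)
    (λ x → S.trans (S.reflexive (≡.cong to (remQuot-combine (idx (f x)) _)))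
                   (J.elt-idx _ (x , _)))
    (λ i → ≡.trans (from-to (remQuot m i)) (combine-remQuot {k} m i))
    where
    open Enum I
    module J i = Enum (J i)
    to : Fin k × Fin m → S.Carrier
    to (i , j) = proj₁ (J.elt i j)
    from : ∀ i x → f x T.≈ elt i → Fin m
    from i x e = J.idx i (x , e)
    -- The index in a fibre does not depend on the proof of membership, because the equality of
    -- `Sub` ignores it.
    combine-cong : ∀ {i i′ x y} → i ≡ i′ → x S.≈ y → ∀ e e′ →
                   combine i (from i x e) ≡ combine i′ (from i′ y e′)
    combine-cong {i} ≡.refl x≈y _ _ = ≡.cong (combine i) (J.idx-cong i x≈y)
    from-to : ∀ ((i , j) : Fin k × Fin m) {e} →
              combine (idx (f (to (i , j)))) (from (idx (f (to (i , j)))) (to (i , j)) e) ≡ combine i j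
    from-to (i , j) with J.elt i j in eq
    ... | x , e = ≡.trans
      (combine-cong (≡.trans (idx-cong e) (idx-elt i)) S.refl _ e)
      (≡.cong (combine i) (≡.trans (≡.cong (J.idx i) (≡.sym eq)) (J.idx-elt i j)))

-- Sequences and their truncations.

module Sequences {a ℓ} (S : Setoid a ℓ) where
  open Setoid S

  Seq : Set a
  Seq = ℕ → Carrier

  tail : Seq → Seq
  tail f i = f (suc i)

  cons : Carrier → Seq → Seq
  cons x f zero    = x
  cons x f (suc i) = f i

  infix 4 _≈[_]_
  _≈[_]_ : Seq → ℕ → Seq → Set ℓ
  f ≈[ n ] g = ∀ i → i < n → f i ≈ g i

  truncated : ℕ → Setoid a ℓ
  truncated n = record
    { Carrier       = Seq
    ; _≈_           = _≈[ n ]_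
    ; isEquivalence = record
      { refl  = λ _ _ → refl
      ; sym   = λ e i p → sym (e i p)
      ; trans = λ e e′ i p → trans (e i p) (e′ i p)
      }
    }

  ≈[]-mono : ∀ {m n} {f g : Seq} → m ≤ n → f ≈[ n ] g → f ≈[ m ] g
  ≈[]-mono m≤n e i i<m = e i (ℕ.<-≤-trans i<m m≤n)

  splice : ℕ → Seq → Seq → Seq
  splice n f g i with i <? n
  ... | yes _ = f i
  ... | no _  = g i

  splice-< : ∀ {n} f g {i} → i < n → splice n f g i ≡ f i
  splice-< {n} f g {i} i<n with i <? n
  ... | yes _  = ≡.refl
  ... | no i≮n = contradiction i<n i≮n

  splice-≥ : ∀ {n} f g {i} → n ≤ i → splice n f g i ≡ g i
  splice-≥ {n} f g {i} n≤i with i <? n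
  ... | yes i<n = contradiction n≤i (ℕ.<⇒≱ i<n)
  ... | no _    = ≡.refl

-- Power series and the kernel condition on Toeplitz systems.

module PowerSeries {c ℓ} (R : CommutativeRing c ℓ) where
  open CommutativeRing R
  open Sequences setoid
  open NaturalSolver commutativeSemiring using (solve; _:=_; _:+_; _:*_; con)

  infixl 7 _⊛_
  -- The Cauchy product, by the recursion f = f 0 + t (tail f) on the first factor.
  _⊛_ : Seq → Seq → Seq
  (f ⊛ g) zero    = f 0 * g 0
  (f ⊛ g) (suc n) = f 0 * g (suc n) + (tail f ⊛ g) n

  𝟘 𝟙 : Seq
  𝟘 _ = 0#
  𝟙   = cons 1# 𝟘

  ⊛-cong : ∀ {n f f′ g g′} → f ≈[ n ] f′ → g ≈[ n ] g′ → f ⊛ g ≈[ n ] f′ ⊛ g′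
  ⊛-cong e e′ zero    p = *-cong (e 0 p) (e′ 0 p)
  ⊛-cong {suc n} e e′ (suc i) p@(s≤s i<n) =
    +-cong (*-cong (e 0 (s≤s z≤n)) (e′ (suc i) p))
           (⊛-cong (λ j j<n → e (suc j) (s≤s j<n)) (≈[]-mono (ℕ.n≤1+n n) e′) i i<n)

  ⊛-zeroˡ : ∀ f n → (𝟘 ⊛ f) n ≈ 0#
  ⊛-zeroˡ f zero    = zeroˡ _
  ⊛-zeroˡ f (suc n) = trans (+-cong (zeroˡ _) (⊛-zeroˡ f n)) (+-identityˡ _)

  ⊛-identityˡ : ∀ f n → (𝟙 ⊛ f) n ≈ f n
  ⊛-identityˡ f zero    = *-identityˡ _
  ⊛-identityˡ f (suc n) = trans (+-cong (*-identityˡ _) (⊛-zeroˡ f n)) (+-identityʳ _)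

  -- Mirrors the defining recursion by splitting g = g 0 + t (tail g); commutativity follows from
  -- the two together.
  ⊛-suc : ∀ f g n → (f ⊛ g) (suc n) ≈ (f ⊛ tail g) n + f (suc n) * g 0
  ⊛-suc f g zero    = refl
  ⊛-suc f g (suc n) = trans (+-congˡ (⊛-suc (tail f) g n)) (sym (+-assoc _ _ _))

  ⊛-comm : ∀ f g n → (f ⊛ g) n ≈ (g ⊛ f) n
  ⊛-comm f g zero    = *-comm _ _
  ⊛-comm f g (suc n) = trans (+-cong (*-comm _ _) (⊛-comm (tail f) g n))
                             (trans (+-comm _ _) (sym (⊛-suc g f n)))

  -- The combination has the shape of `tail (f ⊛ g)`, namely f 0 times `tail g` plus `tail f ⊛ g`;
  -- this is what associativity needs.
  ⊛-linearˡ : ∀ x f g h n →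
              ((λ i → x * f i + g i) ⊛ h) n ≈ x * (f ⊛ h) n + (g ⊛ h) n
  ⊛-linearˡ x f g h zero    = solve 4 (λ x f g h →
    (x :* f :+ g) :* h := x :* (f :* h) :+ g :* h) refl x _ _ _
  ⊛-linearˡ x f g h (suc n) = trans (+-congˡ (⊛-linearˡ x (tail f) (tail g) h n))
    (solve 6 (λ x f g h s t →
       (x :* f :+ g) :* h :+ (x :* s :+ t) := x :* (f :* h :+ s) :+ (g :* h :+ t))
       refl x _ _ _ _ _)

  ⊛-assoc : ∀ f g h n → ((f ⊛ g) ⊛ h) n ≈ (f ⊛ (g ⊛ h)) n
  ⊛-assoc f g h zero    = *-assoc _ _ _
  ⊛-assoc f g h (suc n) = trans
    (+-congˡ (trans (⊛-linearˡ (f 0) (tail g) (tail f ⊛ g) h n)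
                    (+-congˡ (⊛-assoc (tail f) g h n))))
    (solve 5 (λ f g h s t → f :* g :* h :+ (f :* s :+ t) := f :* (g :* h :+ s) :+ t)
       refl _ _ _ _ _)

  -- The usual w = w (h w′) = (w g) w′ = w′, modulo t^n. Letting g and h differ makes this the
  -- congruence of inversion as well.
  inverse-unique : ∀ {n g h w w′} → g ≈[ n ] h → w ⊛ g ≈[ n ] 𝟙 → w′ ⊛ h ≈[ n ] 𝟙 →
                   w ≈[ n ] w′
  inverse-unique {n} {g} {h} {w} {w′} g≈h wg w′h = begin
    w              ≈⟨ (λ i _ → sym (⊛-identityˡ w i)) ⟩
    𝟙 ⊛ w          ≈⟨ (λ i _ → ⊛-comm 𝟙 w i) ⟩
    w ⊛ 𝟙          ≈⟨ ⊛-cong {f = w} (λ _ _ → refl) w′h ⟨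
    w ⊛ (w′ ⊛ h)   ≈⟨ ⊛-cong {f = w} (λ _ _ → refl) (λ i _ → ⊛-comm w′ h i) ⟩
    w ⊛ (h ⊛ w′)   ≈⟨ (λ i _ → ⊛-assoc w h w′ i) ⟨
    (w ⊛ h) ⊛ w′   ≈⟨ ⊛-cong {g = w′} (⊛-cong {f = w} (λ _ _ → refl) g≈h) (λ _ _ → refl) ⟨
    (w ⊛ g) ⊛ w′   ≈⟨ ⊛-cong {g = w′} wg (λ _ _ → refl) ⟩
    𝟙 ⊛ w′         ≈⟨ (λ i _ → ⊛-identityˡ w′ i) ⟩
    w′             ∎
    where open SetoidReasoning (truncated n)

  -- Toeplitz systems as Padé problems: the coefficients n, …, m + n - 1 of the
  -- product of h with a polynomial of degree < m determine that polynomial.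
  TrivialKernel : (m n : ℕ) → Seq → Set (c ⊔ ℓ)
  TrivialKernel m n h = ∀ p → (∀ i → m ≤ i → p i ≈ 0#) →
    (∀ i → n ≤ i → i < m ℕ.+ n → (p ⊛ h) i ≈ 0#) → ∀ i → p i ≈ 0#

  kernel-cong : ∀ m n {h h′} → h ≈[ m ℕ.+ n ] h′ →
                TrivialKernel m n h → TrivialKernel m n h′
  kernel-cong m n e K p deg ann = K p deg λ i n≤i i<m+n →
    trans (⊛-cong {f = p} (λ _ _ → refl) e i i<m+n) (ann i n≤i i<m+n)

  module _ (m n : ℕ) {h : Seq} (h0 : m ≤ suc n ⊎ h 0 ≈ 0#) where
    private
      -- Coefficient i + 1 of p h exceeds coefficient i of p (tail h) by p (i + 1) h 0. This term
      -- vanishes either because p has degree < m ≤ n + 1 ≤ i + 1 or because h 0 = 0, so the two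
      -- systems agree up to a shift of the index.
      shift : ∀ p → (∀ i → m ≤ i → p i ≈ 0#) → ∀ i → n ≤ i →
              (p ⊛ h) (suc i) ≈ (p ⊛ tail h) i
      shift p deg i n≤i =
        trans (⊛-suc p h i) (trans (+-congˡ (vanish h0)) (+-identityʳ _))
        where
        vanish : m ≤ suc n ⊎ h 0 ≈ 0# → p (suc i) * h 0 ≈ 0#
        vanish (inj₁ m≤)  = trans (*-congʳ (deg (suc i) (ℕ.≤-trans m≤ (s≤s n≤i)))) (zeroˡ _)
        vanish (inj₂ h≈0) = trans (*-congˡ h≈0) (zeroʳ _)

    kernel-tail : TrivialKernel m (suc n) h → TrivialKernel m n (tail h)
    kernel-tail K p deg ann = K p deg λ where
      (suc i) (s≤s n≤i) i< → trans (shift p deg i n≤i)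
        (ann i n≤i (ℕ.s≤s⁻¹ (ℕ.<-≤-trans i< (ℕ.≤-reflexive (ℕ.+-suc m n)))))

    kernel-untail : TrivialKernel m n (tail h) → TrivialKernel m (suc n) h
    kernel-untail K p deg ann = K p deg λ i n≤i i< → trans (sym (shift p deg i n≤i))
      (ann (suc i) (s≤s n≤i) (ℕ.≤-trans (s≤s i<) (ℕ.≤-reflexive (≡.sym (ℕ.+-suc m n)))))

  -- Let s have degree < n and let the coefficients m, ..., m + n - 1 of s w vanish. Then s w is,
  -- modulo t^(m + n), a polynomial p of degree < m with p h = s. So p lies in the kernel for h,
  -- whence p = 0 and s = p h = 0.
  kernel-inverse : ∀ m n {h w} → w ⊛ h ≈[ m ℕ.+ n ] 𝟙 →
                   TrivialKernel m n h → TrivialKernel n m w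
  kernel-inverse m n {h} {w} wh K s deg ann = s≈0
    where
    p : Seq
    p = splice m (s ⊛ w) 𝟘

    p≈sw : p ≈[ m ℕ.+ n ] s ⊛ w
    p≈sw i i< with i <? m
    ... | yes _  = refl
    ... | no i≮m = sym (ann i (ℕ.≮⇒≥ i≮m) (ℕ.<-≤-trans i< (ℕ.≤-reflexive (ℕ.+-comm m n))))

    ph≈s : p ⊛ h ≈[ m ℕ.+ n ] s
    ph≈s = begin
      p ⊛ h        ≈⟨ ⊛-cong {g = h} p≈sw (λ _ _ → refl) ⟩
      (s ⊛ w) ⊛ h  ≈⟨ (λ i _ → ⊛-assoc s w h i) ⟩
      s ⊛ (w ⊛ h)  ≈⟨ ⊛-cong {f = s} (λ _ _ → refl) wh ⟩
      s ⊛ 𝟙        ≈⟨ (λ i _ → ⊛-comm s 𝟙 i) ⟩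
      𝟙 ⊛ s        ≈⟨ (λ i _ → ⊛-identityˡ s i) ⟩
      s            ∎
      where open SetoidReasoning (truncated (m ℕ.+ n))

    p≈0 : ∀ i → p i ≈ 0#
    p≈0 = K p (λ i m≤i → reflexive (splice-≥ (s ⊛ w) 𝟘 m≤i))
              (λ i n≤i i< → trans (ph≈s i i<) (deg i n≤i))

    s≈0 : ∀ i → s i ≈ 0#
    s≈0 i with i <? n
    ... | no i≮n  = deg i (ℕ.≮⇒≥ i≮n)
    ... | yes i<n = trans (sym (ph≈s i (ℕ.<-≤-trans i<n (ℕ.m≤n+m n m))))
      (trans (⊛-cong {suc i} {g = h} (λ j _ → p≈0 j) (λ _ _ → refl) i ℕ.≤-refl)
             (⊛-zeroˡ h i))

  -- If h 0 = 0, then t^m has degree < m + 1 and t^m h vanishes modulo t^(m + 1).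
  kernel-head : ∀ m {h} → ¬ 1# ≈ 0# → TrivialKernel (suc m) 0 h → ¬ h 0 ≈ 0#
  kernel-head m {h} 1≉0 K h≈0 = 1≉0 (begin
    1#         ≡⟨ splice-< (λ _ → 1#) 𝟘 (ℕ.n<1+n m) ⟨
    monomial m ≡⟨ splice-≥ 𝟘 monomial (ℕ.≤-refl {m}) ⟨
    p m        ≈⟨ K p deg ann m ⟩
    0#         ∎)
    where
    open SetoidReasoning setoid
    monomial p : Seq
    -- This is 1 + t + ⋯ + t^m; removing the coefficients below m leaves p = t^m.
    monomial = splice (suc m) (λ _ → 1#) 𝟘
    p = splice m 𝟘 monomial

    deg : ∀ i → suc m ≤ i → p i ≈ 0#
    deg i m<i = trans (reflexive (splice-≥ 𝟘 monomial (ℕ.<⇒≤ m<i)))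
                      (reflexive (splice-≥ (λ _ → 1#) 𝟘 m<i))

    ann : ∀ i → 0 ≤ i → i < suc m ℕ.+ 0 → (p ⊛ h) i ≈ 0#
    ann zero    _ _  = trans (*-congˡ h≈0) (zeroʳ _)
    ann (suc i) _ i< = begin
      (p ⊛ h) (suc i)                  ≈⟨ ⊛-comm p h (suc i) ⟩
      h 0 * p (suc i) + (tail h ⊛ p) i ≈⟨ +-cong (trans (*-congʳ h≈0) (zeroˡ _)) (⊛-comm (tail h) p i) ⟩
      0# + (p ⊛ tail h) i              ≈⟨ +-identityˡ _ ⟩
      (p ⊛ tail h) i                   ≈⟨ ⊛-cong {m} {g = tail h} (λ j j<m → reflexive (splice-< 𝟘 monomial j<m)) (λ _ _ → refl) i
                                            (ℕ.s≤s⁻¹ (ℕ.<-≤-trans i< (ℕ.≤-reflexive (ℕ.+-identityʳ (suc m))))) ⟩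
      (𝟘 ⊛ tail h) i                   ≈⟨ ⊛-zeroˡ (tail h) i ⟩
      0#                               ∎

  -- The exchange with an inverse reduces this to polynomials of degree < 0, of which 0 is the only
  -- one.
  kernel-unit : ∀ m {h w} → w ⊛ h ≈[ m ℕ.+ 0 ] 𝟙 → TrivialKernel m 0 h
  kernel-unit m {h} {w} wh = kernel-inverse 0 m
    (λ i i< → trans (⊛-comm h w i) (wh i (ℕ.<-≤-trans i< (ℕ.≤-reflexive (ℕ.+-comm 0 m)))))
    λ p deg _ i → deg i z≤n

  module Division (_⁻¹ : Carrier → Carrier) (inverseˡ : ∀ {x} → ¬ x ≈ 0# → x ⁻¹ * x ≈ 1#) where

    -- Long division: after subtracting h 0 ⁻¹ g 0 times h from g, the remainder is divided by t and
    -- the division by h goes on.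
    quotient : Seq → Seq → Seq
    quotient g h zero    = h 0 ⁻¹ * g 0
    quotient g h (suc n) = quotient (λ i → g (suc i) + - (h 0 ⁻¹ * g 0 * h (suc i))) h n

    quotient-⊛ : ∀ g {h} → ¬ h 0 ≈ 0# → ∀ n → (quotient g h ⊛ h) n ≈ g n
    quotient-⊛ g {h} h≉0 zero    = trans
      (solve 3 (λ x y z → x :* y :* z := x :* z :* y) refl _ _ _)
      (trans (*-congʳ (inverseˡ h≉0)) (*-identityˡ _))
    quotient-⊛ g {h} h≉0 (suc n) = trans (+-congˡ (quotient-⊛ _ h≉0 n))
      (trans (solve 3 (λ x y z → x :+ (y :+ z) := y :+ (x :+ z)) refl _ _ _)
        (trans (+-congˡ (-‿inverseʳ _)) (+-identityʳ _)))

    inv : Seq → Seq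
    inv = quotient 𝟙

    inv-⊛ : ∀ {h} → ¬ h 0 ≈ 0# → ∀ n → (inv h ⊛ h) n ≈ 𝟙 n
    inv-⊛ = quotient-⊛ 𝟙

-- Counting sequences with prescribed first terms.

module _ {a ℓ} {S : Setoid a ℓ} where
  open Setoid S
  open Sequences S

  -- Fibring over the term n fixes one more term, with q choices. For d = 0 all terms below N are
  -- prescribed, and they alone matter for the equality of `truncated N`.
  extensions-size : ∀ {q} → HasSize S q → ∀ d {n N} → d ℕ.+ n ≡ N → ∀ x →
                    HasSize (Sub (truncated N) λ z → z ≈[ n ] x) (q ^ d)
  extensions-size I zero    ≡.refl x = mkSize (λ _ → x , λ _ _ → refl) (λ _ → zero)
    (λ _ → ≡.refl) (λ (z , e) i i< → sym (e i i<)) (λ { zero → ≡.refl ; (suc ()) })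
  extensions-size I (suc d) {n} {N} d+n x =
    fibre-size {T = S} (λ (z , _) → z n) (λ e → e n n<N) I λ i →
      -- Only the first n + 1 terms of y matter: those of x, then the chosen value.
      let y = splice n x (λ _ → Inverse.to I i) in
      transfer
        (λ (z , e) → (z , λ j j<n → trans (e j (ℕ.m<n⇒m<1+n j<n)) (reflexive (splice-< x _ j<n))) ,
                     trans (e n ℕ.≤-refl) (reflexive (splice-≥ x _ (ℕ.≤-refl {n}))))
        (λ ((z , e) , t) → z , λ j j≤n → extend (λ k → z k ≈ y k)
           (λ j<n → trans (e j j<n) (reflexive (≡.sym (splice-< x _ j<n))))
           (trans t (reflexive (≡.sym (splice-≥ x _ (ℕ.≤-refl {n}))))) j≤n)
        id id (λ _ _ _ → refl) (λ _ _ _ → refl)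
        (extensions-size I d (≡.trans (ℕ.+-suc d n) d+n) y)
    where
    n<N : n < N
    n<N = ℕ.<-≤-trans (s≤s (ℕ.m≤n+m n d)) (ℕ.≤-reflexive d+n)
    extend : ∀ {p} (P : ℕ → Set p) {j} → (j < n → P j) → P n → j < suc n → P j
    extend P {j} P< Pn j≤n with ℕ.m<1+n⇒m<n∨m≡n j≤n
    ... | inj₁ j<n    = P< j<n
    ... | inj₂ ≡.refl = Pn

-- Counting series with trivial kernel and prescribed first coefficients.

module _ {c ℓ} (R : CommutativeRing c ℓ) where
  open CommutativeRing R

  module Counting (_⁻¹ : Carrier → Carrier) (inverseˡ : ∀ {x} → ¬ x ≈ 0# → x ⁻¹ * x ≈ 1#)
    (1≉0 : ¬ 1# ≈ 0#) {q : ℕ} (I : HasSize setoid q) where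

    open Sequences setoid
    open PowerSeries R
    open Division _⁻¹ inverseˡ
    open Enum I using () renaming (≈-dec to _≟_)

    Solutions : (N m n : ℕ) → Seq → Setoid _ _
    Solutions N m n x = Sub (truncated N) λ h → h ≈[ n ] x × TrivialKernel m n h

    unit⇒inv-unit : ∀ {h} → ¬ h 0 ≈ 0# → ¬ inv h 0 ≈ 0#
    unit⇒inv-unit {h} h≉0 w≈0 =
      1≉0 (trans (sym (inv-⊛ {h} h≉0 0)) (trans (*-congʳ w≈0) (zeroˡ _)))

    inv-cong : ∀ {n g h} → ¬ g 0 ≈ 0# → ¬ h 0 ≈ 0# → g ≈[ n ] h → inv g ≈[ n ] inv h
    inv-cong g≉0 h≉0 g≈h = inverse-unique g≈h (λ i _ → inv-⊛ g≉0 i) (λ i _ → inv-⊛ h≉0 i)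

    inv-involutive : ∀ {h} → ¬ h 0 ≈ 0# → ∀ n → inv (inv h) n ≈ h n
    inv-involutive {h} h≉0 n = inverse-unique {suc n} {inv h} (λ _ _ → refl)
      (λ i _ → inv-⊛ (unit⇒inv-unit {h} h≉0) i)
      (λ i _ → trans (⊛-comm h (inv h) i) (inv-⊛ {h} h≉0 i)) n ℕ.≤-refl

    -- For n = 0 the kernel is trivial exactly for units: there are q - 1 choices of the constant
    -- term, and the m coefficients after it are free.
    solutions-size-0 : ∀ m x → HasSize (Solutions (suc m ℕ.+ 0) (suc m) 0 x) ((q ∸ 1) ℕ.* q ^ m)
    solutions-size-0 m x =
      fibre-size {T = Sub setoid λ y → ¬ y ≈ 0#} (λ (h , _ , K) → h 0 , kernel-head m 1≉0 K)
        (λ e → e 0 (s≤s z≤n)) nonzero λ i →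
          let t , t≉0 = Inverse.to nonzero i in
          transfer
            (λ (h , e) → (h , (λ _ ()) , kernel-unit (suc m) {w = inv h}
               λ j _ → inv-⊛ (λ h≈0 → t≉0 (trans (sym (e 0 (s≤s z≤n))) h≈0)) j) , e 0 (s≤s z≤n))
            (λ ((h , _) , e) → h , λ { zero (s≤s z≤n) → e })
            id id (λ _ _ _ → refl) (λ _ _ _ → refl)
            (extensions-size I m (ℕ.+-suc m 0) (λ _ → t))
      where nonzero = nonElement-size 0# I

    -- The constant term of a solution is prescribed as x 0, so `tail` and `cons (x 0)` are mutually
    -- inverse on solutions.
    solutions-size-tail : ∀ m n x {k} → m ≤ suc n ⊎ x 0 ≈ 0# →
      HasSize (Solutions (m ℕ.+ n) m n (tail x)) k →
      HasSize (Solutions (m ℕ.+ suc n) m (suc n) x) k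
    solutions-size-tail m n x x0 = transfer
      (λ (h , e , K) → cons (x 0) h , (λ { zero _ → refl ; (suc i) (s≤s i<) → e i i< }) ,
         kernel-untail m n x0 K)
      (λ (h , e , K) → tail h , (λ i i< → e (suc i) (s≤s i<)) ,
         kernel-tail m n (head-vanishes e x0) K)
      (λ { e zero _ → refl
         ; e (suc i) i< → e i (ℕ.s≤s⁻¹ (ℕ.≤-trans i< (ℕ.≤-reflexive (ℕ.+-suc m n)))) })
      (λ e i i< → e (suc i) (ℕ.≤-trans (s≤s i<) (ℕ.≤-reflexive (≡.sym (ℕ.+-suc m n)))))
      (λ { (h , e , _) zero _ → sym (e 0 (s≤s z≤n)) ; _ (suc i) _ → refl })
      (λ _ _ _ → refl)
      where
      head-vanishes : ∀ {h} → h ≈[ suc n ] x → m ≤ suc n ⊎ x 0 ≈ 0# → m ≤ suc n ⊎ h 0 ≈ 0#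
      head-vanishes e (inj₁ m≤)  = inj₁ m≤
      head-vanishes e (inj₂ x≈0) = inj₂ (trans (e 0 (s≤s z≤n)) x≈0)

    -- Inversion is a bijection onto the series w that begin with the n + 1 coefficients of `inv x`
    -- and have trivial kernel for n + 1 and m. Sorted by their first m coefficients, of which m - n
    -- - 1 are free, these w form q^(m - n - 1) instances of the exchanged problem.
    solutions-size-inv : ∀ m n x {k} → n < m → ¬ x 0 ≈ 0# →
      (∀ y → HasSize (Solutions (suc n ℕ.+ m) (suc n) m y) k) →
      HasSize (Solutions (m ℕ.+ suc n) m (suc n) x) (q ^ (m ∸ suc n) ℕ.* k)
    solutions-size-inv m n x n<m x≉0 sizes = transfer
      (λ (w , e , K) →
         inv w ,
         (λ i i< → trans (inv-cong (unit e) inv-x≉0 e i i<) (inv-involutive {x} x≉0 i)) ,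
         kernel-inverse (suc n) m (λ i _ → inv-⊛ (unit e) i) K)
      (λ (h , e , K) →
         inv h , inv-cong (unit′ e) x≉0 e ,
         kernel-inverse m (suc n) (λ i _ → inv-⊛ (unit′ e) i) K)
      (λ {(_ , e , _)} {(_ , e′ , _)} → inv-cong (unit e) (unit e′))
      (λ {(_ , e , _)} {(_ , e′ , _)} → inv-cong (unit′ e) (unit′ e′))
      (λ (_ , e , _) i _ → inv-involutive (unit′ e) i)
      (λ (_ , e , _) i _ → inv-involutive (unit e) i)
      inverses-size
      where
      inv-x≉0 : ¬ inv x 0 ≈ 0#
      inv-x≉0 = unit⇒inv-unit {x} x≉0
      unit : ∀ {w} → w ≈[ suc n ] inv x → ¬ w 0 ≈ 0#
      unit e w≈0 = inv-x≉0 (trans (sym (e 0 (s≤s z≤n))) w≈0)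
      unit′ : ∀ {h} → h ≈[ suc n ] x → ¬ h 0 ≈ 0#
      unit′ e h≈0 = x≉0 (trans (sym (e 0 (s≤s z≤n))) h≈0)
      prefixes : HasSize (Sub (truncated m) λ z → z ≈[ suc n ] inv x) (q ^ (m ∸ suc n))
      prefixes = extensions-size I (m ∸ suc n) (ℕ.m∸n+n≡m n<m) (inv x)
      inverses-size : HasSize
        (Sub (truncated (m ℕ.+ suc n)) λ w → w ≈[ suc n ] inv x × TrivialKernel (suc n) m w) _
      inverses-size = fibre-size (λ (w , e , _) → w , e) (≈[]-mono (ℕ.m≤m+n m (suc n)))
        prefixes λ i →
          let z , z≈ = Inverse.to prefixes i in
          transfer
            (λ (w , e , K) → (w , (λ j j< → trans (e j (ℕ.<-≤-trans j< n<m)) (z≈ j j<)) , K) , e)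
            (λ ((w , _ , K) , e) → w , e , K)
            (≈[]-mono (ℕ.≤-reflexive (ℕ.+-comm m (suc n))))
            (≈[]-mono (ℕ.≤-reflexive (ℕ.+-comm (suc n) m)))
            (λ _ _ _ → refl) (λ _ _ _ → refl) (sizes z)

    private
      -- The recursion is lexicographic: a shift keeps m and lowers n, while the exchange raises n
      -- but strictly lowers m.
      solutions-size-acc : ∀ m → Acc _<_ m → ∀ n x →
        HasSize (Solutions (suc m ℕ.+ n) (suc m) n x) ((q ∸ 1) ℕ.* q ^ m)
      solutions-size-acc m _          zero    x = solutions-size-0 m x
      solutions-size-acc m a@(acc rs) (suc n) x with n <? m | x 0 ≟ 0#
      ... | no n≮m  | _       = solutions-size-tail (suc m) n x (inj₁ (s≤s (ℕ.≮⇒≥ n≮m)))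
                                  (solutions-size-acc m a n (tail x))
      ... | yes _   | yes x≈0 = solutions-size-tail (suc m) n x (inj₂ x≈0)
                                  (solutions-size-acc m a n (tail x))
      ... | yes n<m | no x≉0  = ≡.subst (HasSize _) exponents
        (solutions-size-inv (suc m) n x (ℕ.m<n⇒m<1+n n<m) x≉0
          (solutions-size-acc n (rs n<m) (suc m)))
        where
        open ≡.≡-Reasoning
        exponents : q ^ (m ∸ n) ℕ.* ((q ∸ 1) ℕ.* q ^ n) ≡ (q ∸ 1) ℕ.* q ^ m
        exponents = begin
          q ^ (m ∸ n) ℕ.* ((q ∸ 1) ℕ.* q ^ n)  ≡⟨ solve 3 (λ x y z → x :* (y :* z) := y :* (x :* z))
                                                    ≡.refl (q ^ (m ∸ n)) (q ∸ 1) (q ^ n) ⟩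
          (q ∸ 1) ℕ.* (q ^ (m ∸ n) ℕ.* q ^ n)  ≡⟨ ≡.cong ((q ∸ 1) ℕ.*_) (ℕ.^-distribˡ-+-* q (m ∸ n) n) ⟨
          (q ∸ 1) ℕ.* q ^ (m ∸ n ℕ.+ n)        ≡⟨ ≡.cong (λ e → (q ∸ 1) ℕ.* q ^ e) (ℕ.m∸n+n≡m (ℕ.<⇒≤ n<m)) ⟩
          (q ∸ 1) ℕ.* q ^ m                    ∎
          where open +-*-Solver

    solutions-size : ∀ m n x → HasSize (Solutions (suc m ℕ.+ n) (suc m) n x) ((q ∸ 1) ℕ.* q ^ m)
    solutions-size m = solutions-size-acc m (<-wellFounded m)

-- Determinants as functions of a list of columns.

module Columns {c ℓ} (R : CommutativeRing c ℓ) where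
  open CommutativeRing R hiding (zero)
  open NaturalSolver commutativeSemiring using (solve; _:=_; _:+_; _:*_; con)
  open SemiringSum semiring using (sum; sum-cong-≋; *-distribˡ-sum)
  open RawSemiringDefs (Semiring.rawSemiring semiring) using () renaming (_^_ to _^ᴿ_)
  open SetoidReasoning setoid

  private variable
    m n : ℕ

  Column : ℕ → Set c
  Column m = Fin m → Carrier

  below : Column (suc m) → Column m
  below c r = c (suc r)

  infixl 6 _+[_]_
  _+[_]_ : Column m → Carrier → Column m → Column m
  (c +[ x ] d) r = c r + x * d r

  cancel : ∀ x → x + - 1# * x ≈ 0#
  cancel x = trans (solve 2 (λ n x → x :+ n :* x := (con 1 :+ n) :* x) refl (- 1#) x)
                   (trans (*-congʳ (-‿inverseʳ 1#)) (zeroˡ x))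

  drop-zero : ∀ {x z} → z ≈ 0# → x + z ≈ x
  drop-zero z≈0 = trans (+-congˡ z≈0) (+-identityʳ _)

  -- Laplace expansion along the first row, where f stands for the minors of the
  -- remaining rows: recursion on the columns moves the first column into f.
  -- Signs are written - 1# * x, so that a semiring solver can handle them.
  expand : (Vec (Column m) n → Carrier) → Vec (Column (suc m)) (suc n) → Carrier
  expand f (c ∷ [])     = c zero * f []
  expand f (c ∷ d ∷ cs) =
    c zero * f (map below (d ∷ cs)) + - 1# * expand (λ ds → f (below c ∷ ds)) (d ∷ cs)

  colDet : ∀ n → Vec (Column n) n → Carrier
  colDet zero    _ = 1#
  colDet (suc n)   = expand (colDet n)

  expand-∷ : ∀ (f : Vec (Column m) (suc n) → Carrier) c cs →
    expand f (c ∷ cs) ≡ c zero * f (map below cs) + - 1# * expand (λ ds → f (below c ∷ ds)) cs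
  expand-∷ f c (_ ∷ _) = ≡.refl

  -- Every term after the first carries a factor `- 1#` more than in the sum for the remaining
  -- columns; it is pulled out while the first column moves into the minors.
  sum-expand : (f : Vec (Column m) n → Carrier) (M : Fin (suc n) → Column (suc m)) →
    sum (λ j → (- 1#) ^ᴿ toℕ j * (M j zero * f (tabulate λ k → below (M (punchIn j k))))) ≈
    expand f (tabulate M)
  sum-expand {n = zero}  f M = trans (+-identityʳ _) (*-identityˡ _)
  sum-expand {n = suc n} f M = begin
    1# * (M zero zero * f (tabulate (below ∘ M ∘ suc))) +
      sum (λ j → - 1# * (- 1#) ^ᴿ toℕ j * term j)
        ≈⟨ +-cong (trans (*-identityˡ _) (*-congˡ (reflexive (≡.cong f (tabulate-∘ below (M ∘ suc))))))
                  (sum-cong-≋ {suc n} (λ j → *-assoc (- 1#) ((- 1#) ^ᴿ toℕ j) (term j))) ⟩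
    M zero zero * f (map below (tabulate (M ∘ suc))) +
      sum (λ j → - 1# * ((- 1#) ^ᴿ toℕ j * term j))
        ≈⟨ +-congˡ (*-distribˡ-sum {suc n} (- 1#) (λ j → (- 1#) ^ᴿ toℕ j * term j)) ⟨
    M zero zero * f (map below (tabulate (M ∘ suc))) +
      - 1# * sum (λ j → (- 1#) ^ᴿ toℕ j * term j)
        ≈⟨ +-congˡ (*-congˡ (sum-expand (λ ds → f (below (M zero) ∷ ds)) (M ∘ suc))) ⟩
    expand f (tabulate M) ∎
    where
    term : Fin (suc n) → Carrier
    term j = M (suc j) zero * f (below (M zero) ∷ tabulate λ k → below (M (suc (punchIn j k))))

  determinant-columns : ∀ n M → determinant R n M ≈ colDet n (tabulate λ k r → M r k)
  determinant-columns zero    M = refl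
  determinant-columns (suc n) M = trans
    (sum-cong-≋ {suc n} λ j → *-congˡ {(- 1#) ^ᴿ toℕ j}
      (*-congˡ {M zero j} (determinant-columns n λ r k → M (suc r) (punchIn j k))))
    (sum-expand (colDet n) λ k r → M r k)

  -- Multilinearity is stated through three lists that agree except in one column, so that the
  -- position of that column is available for induction.
  data Combines (x : Carrier) {m} : (A B C : Vec (Column m) n) → Set c where
    here  : ∀ {a b} {cs : Vec (Column m) n} → Combines x (a ∷ cs) (b ∷ cs) (a +[ x ] b ∷ cs)
    there : ∀ {c} {A B C : Vec (Column m) n} → Combines x A B C → Combines x (c ∷ A) (c ∷ B) (c ∷ C)

  infix 4 _↝_
  -- Only additions between neighbouring columns are allowed. They preserve the determinant without
  -- a sign or a factor, and they suffice for the elimination.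
  data _↝_ {m} : (A B : Vec (Column m) n) → Set c where
    addˡ : ∀ x {c d} {cs : Vec (Column m) n} → c ∷ d ∷ cs ↝ c +[ x ] d ∷ d ∷ cs
    addʳ : ∀ x {c d} {cs : Vec (Column m) n} → c ∷ d ∷ cs ↝ c ∷ d +[ x ] c ∷ cs
    skip : ∀ {c} {A B : Vec (Column m) n} → A ↝ B → c ∷ A ↝ c ∷ B

  below-combines : ∀ {x} {A B C : Vec (Column (suc m)) n} → Combines x A B C →
                   Combines x (map below A) (map below B) (map below C)
  below-combines here      = here
  below-combines (there r) = there (below-combines r)

  below-↝ : {A B : Vec (Column (suc m)) n} → A ↝ B → map below A ↝ map below B
  below-↝ (addˡ x)  = addˡ x
  below-↝ (addʳ x)  = addʳ x
  below-↝ (skip op) = skip (below-↝ op)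

  Multilinear Invariant : (Vec (Column m) n → Carrier) → Set (c ⊔ ℓ)
  Multilinear f = ∀ {x A B C} → Combines x A B C → f C ≈ f A + x * f B
  Invariant f = ∀ {A B} → A ↝ B → f B ≈ f A

  expand-cong : {f g : Vec (Column m) n → Carrier} → (∀ ds → f ds ≈ g ds) →
                ∀ cs → expand f cs ≈ expand g cs
  expand-cong e (c ∷ [])     = *-congˡ (e [])
  expand-cong e (c ∷ d ∷ cs) =
    +-cong (*-congˡ (e _)) (*-congˡ (expand-cong (λ ds → e (below c ∷ ds)) (d ∷ cs)))

  expand-linear : ∀ x (f g : Vec (Column m) n → Carrier) cs →
    expand (λ ds → f ds + x * g ds) cs ≈ expand f cs + x * expand g cs
  expand-linear x f g (c ∷ [])     = solve 4
    (λ x c f g → c :* (f :+ x :* g) := c :* f :+ x :* (c :* g)) refl x (c zero) _ _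
  expand-linear x f g (c ∷ d ∷ cs) = trans
    (+-congˡ (*-congˡ (expand-linear x _ _ (d ∷ cs))))
    (solve 7 (λ x c f g n s t → c :* (f :+ x :* g) :+ n :* (s :+ x :* t) :=
                                (c :* f :+ n :* s) :+ x :* (c :* g :+ n :* t))
       refl x (c zero) _ _ (- 1#) _ _)

  expand-multilinear : (f : Vec (Column m) n → Carrier) → Multilinear f → Multilinear (expand f)
  expand-multilinear f lin (here {cs = []})     = solve 4
    (λ x a b f → (a :+ x :* b) :* f := a :* f :+ x :* (b :* f)) refl _ _ _ _
  expand-multilinear f lin (here {a = a} {b} {cs = d ∷ cs}) = trans
    (+-congˡ (*-congˡ (trans (expand-cong (λ ds → lin here) (d ∷ cs)) (expand-linear _ _ _ (d ∷ cs)))))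
    (solve 7 (λ x a b f n s t → (a :+ x :* b) :* f :+ n :* (s :+ x :* t) :=
                                (a :* f :+ n :* s) :+ x :* (b :* f :+ n :* t))
       refl _ (a zero) (b zero) _ (- 1#) _ _)
  expand-multilinear {n = suc n} f lin {x} (there {c = c} {A} {B} {C} r) = begin
    expand f (c ∷ C)
      ≡⟨ expand-∷ f c C ⟩
    c zero * f (map below C) + - 1# * expand (λ ds → f (below c ∷ ds)) C
      ≈⟨ +-cong (*-congˡ (lin (below-combines r)))
                (*-congˡ (expand-multilinear _ (lin ∘ there) r)) ⟩
    c zero * (f (map below A) + x * f (map below B)) +
      - 1# * (expand (λ ds → f (below c ∷ ds)) A + x * expand (λ ds → f (below c ∷ ds)) B)
      ≈⟨ solve 7 (λ x c f g n s t → c :* (f :+ x :* g) :+ n :* (s :+ x :* t) :=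
                                (c :* f :+ n :* s) :+ x :* (c :* g :+ n :* t))
           refl x (c zero) _ _ (- 1#) _ _ ⟩
    (c zero * f (map below A) + - 1# * expand (λ ds → f (below c ∷ ds)) A) +
      x * (c zero * f (map below B) + - 1# * expand (λ ds → f (below c ∷ ds)) B)
      ≡⟨ ≡.cong₂ (λ s t → s + x * t) (expand-∷ f c A) (expand-∷ f c B) ⟨
    expand f (c ∷ A) + x * expand f (c ∷ B) ∎

  -- For an operation on the first two columns, the two terms that belong to them change by opposite
  -- amounts, by multilinearity of f. All other minors contain both columns and keep their values by
  -- invariance of f.
  expand-invariant : (f : Vec (Column m) n → Carrier) → Multilinear f → Invariant f →
                     Invariant (expand f)
  expand-invariant f lin inv (addˡ x {c} {d} {[]}) = begin
    (c zero + x * d zero) * f (below d ∷ []) + - 1# * (d zero * f (below c +[ x ] below d ∷ []))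
      ≈⟨ +-congˡ (*-congˡ (*-congˡ (lin here))) ⟩
    (c zero + x * d zero) * f (below d ∷ []) +
      - 1# * (d zero * (f (below c ∷ []) + x * f (below d ∷ [])))
      ≈⟨ solve 6 (λ n x c d s t → (c :+ x :* d) :* s :+ n :* (d :* (t :+ x :* s)) :=
                  (c :* s :+ n :* (d :* t)) :+ (x :* d :* s :+ n :* (x :* d :* s)))
           refl (- 1#) x (c zero) (d zero) _ _ ⟩
    _ ≈⟨ drop-zero (cancel _) ⟩
    c zero * f (below d ∷ []) + - 1# * (d zero * f (below c ∷ [])) ∎
  expand-invariant f lin inv (addˡ x {c} {d} {e ∷ cs}) = trans
    (+-congˡ (*-congˡ (+-cong (*-congˡ (lin here))
                              (*-congˡ (expand-cong (λ ds → inv (addˡ x)) (e ∷ cs))))))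
    (trans
      (solve 7 (λ n x c d s t u → (c :+ x :* d) :* s :+ n :* (d :* (t :+ x :* s) :+ u) :=
                  (c :* s :+ n :* (d :* t :+ u)) :+ (x :* d :* s :+ n :* (x :* d :* s)))
         refl (- 1#) x (c zero) (d zero) _ _ _)
      (drop-zero (cancel _)))
  expand-invariant f lin inv (addʳ x {c} {d} {[]}) = trans
    (+-congʳ (*-congˡ (lin here)))
    (trans
      (solve 6 (λ n x c d s t → c :* (s :+ x :* t) :+ n :* ((d :+ x :* c) :* t) :=
                  (c :* s :+ n :* (d :* t)) :+ (x :* c :* t :+ n :* (x :* c :* t)))
         refl (- 1#) x (c zero) (d zero) _ _)
      (drop-zero (cancel _)))
  expand-invariant f lin inv (addʳ x {c} {d} {e ∷ cs}) = trans
    (+-cong (*-congˡ (lin here))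
            (*-congˡ (+-congˡ (*-congˡ (expand-cong (λ ds → inv (addʳ x)) (e ∷ cs))))))
    (trans
      (solve 7 (λ n x c d s t u → c :* (s :+ x :* t) :+ n :* ((d :+ x :* c) :* t :+ u) :=
                  (c :* s :+ n :* (d :* t :+ u)) :+ (x :* c :* t :+ n :* (x :* c :* t)))
         refl (- 1#) x (c zero) (d zero) _ _ _)
      (drop-zero (cancel _)))
  expand-invariant {n = suc n} f lin inv (skip {c = c} {A} {B} op) = begin
    expand f (c ∷ B)
      ≡⟨ expand-∷ f c B ⟩
    c zero * f (map below B) + - 1# * expand (λ ds → f (below c ∷ ds)) B
      ≈⟨ +-cong (*-congˡ (inv (below-↝ op)))
                (*-congˡ (expand-invariant _ (lin ∘ there) (inv ∘ skip) op)) ⟩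
    c zero * f (map below A) + - 1# * expand (λ ds → f (below c ∷ ds)) A
      ≡⟨ expand-∷ f c A ⟨
    expand f (c ∷ A) ∎

  colDet-multilinear : ∀ n → Multilinear (colDet n)
  colDet-multilinear zero    ()
  colDet-multilinear (suc n) = expand-multilinear (colDet n) (colDet-multilinear n)

  colDet-invariant : ∀ n → Invariant (colDet n)
  colDet-invariant zero    ()
  colDet-invariant (suc n) =
    expand-invariant (colDet n) (colDet-multilinear n) (colDet-invariant n)

  expand-zero : ∀ (f : Vec (Column m) n → Carrier) cs → All (λ c → c zero ≈ 0#) cs → expand f cs ≈ 0#
  expand-zero f (c ∷ [])     (z ∷ _)  = trans (*-congʳ z) (zeroˡ _)
  expand-zero f (c ∷ d ∷ cs) (z ∷ zs) = trans
    (drop-zero (trans (*-congˡ (expand-zero _ (d ∷ cs) zs)) (zeroʳ _)))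
    (trans (*-congʳ z) (zeroˡ _))

  expand-pivot : ∀ (f : Vec (Column m) n → Carrier) c cs → All (λ c → c zero ≈ 0#) cs →
                 expand f (c ∷ cs) ≈ c zero * f (map below cs)
  expand-pivot f c []       _  = refl
  expand-pivot f c (d ∷ cs) zs = drop-zero (trans (*-congˡ (expand-zero _ (d ∷ cs) zs)) (zeroʳ _))

  -- Linear combinations of columns under column operations.

  infix 8 _·_
  _·_ : Vec (Column m) n → Vec Carrier n → Column m
  ([] · [])             r = 0#
  ((c ∷ cs) · (x ∷ xs)) r = x * c r + (cs · xs) r

  below-· : ∀ (cs : Vec (Column (suc m)) n) xs r → (map below cs · xs) r ≡ (cs · xs) (suc r)
  below-· []       []       r = ≡.refl
  below-· (c ∷ cs) (x ∷ xs) r = ≡.cong (x * c (suc r) +_) (below-· cs xs r)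

  ·-zero : ∀ {cs : Vec (Column (suc m)) n} → All (λ c → c zero ≈ 0#) cs → ∀ xs → (cs · xs) zero ≈ 0#
  ·-zero []       []       = refl
  ·-zero (z ∷ zs) (x ∷ xs) = trans (drop-zero (·-zero zs xs)) (trans (*-congˡ z) (zeroʳ x))

  Zero : Vec Carrier n → Set (c ⊔ ℓ)
  Zero = All (_≈ 0#)

  infix 4 _≼_
  -- Inclusion of spans, with the addition that nontrivial coefficients stay nontrivial. In both
  -- directions it transports spanning, independence and dependence.
  _≼_ : Vec (Column m) n → Vec (Column m) n → Set (c ⊔ ℓ)
  A ≼ B = ∀ xs → ∃ λ ys → (∀ r → (A · xs) r ≈ (B · ys) r) × (Zero ys → Zero xs)

  -- The coefficients undo the operation: y c + z d = y (c + x d) + (z - x y) d, and symmetrically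
  -- for `addʳ`.
  ↝⇒≼ : {A B : Vec (Column m) n} → A ↝ B → A ≼ B
  ↝⇒≼ (addˡ x) (y ∷ z ∷ zs) = y ∷ z + - 1# * (x * y) ∷ zs ,
    (λ r → sym (trans
      (solve 7 (λ n x y z c d s → y :* (c :+ x :* d) :+ ((z :+ n :* (x :* y)) :* d :+ s) :=
                  (y :* c :+ (z :* d :+ s)) :+ (x :* y :* d :+ n :* (x :* y :* d)))
         refl (- 1#) x y z _ _ _)
      (drop-zero (cancel _)))) ,
    λ { (y≈0 ∷ z≈0 ∷ zs≈0) → y≈0 ∷ trans (sym (drop-zero
          (trans (*-congˡ (trans (*-congˡ y≈0) (zeroʳ _))) (zeroʳ _)))) z≈0 ∷ zs≈0 }
  ↝⇒≼ (addʳ x) (y ∷ z ∷ zs) = y + - 1# * (x * z) ∷ z ∷ zs ,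
    (λ r → sym (trans
      (solve 7 (λ n x y z c d s → (y :+ n :* (x :* z)) :* c :+ (z :* (d :+ x :* c) :+ s) :=
                  (y :* c :+ (z :* d :+ s)) :+ (x :* z :* c :+ n :* (x :* z :* c)))
         refl (- 1#) x y z _ _ _)
      (drop-zero (cancel _)))) ,
    λ { (y≈0 ∷ z≈0 ∷ zs≈0) → trans (sym (drop-zero
          (trans (*-congˡ (trans (*-congˡ z≈0) (zeroʳ _))) (zeroʳ _)))) y≈0 ∷ z≈0 ∷ zs≈0 }
  ↝⇒≼ (skip op) (x ∷ xs) with ys , e , z ← ↝⇒≼ op xs =
    x ∷ ys , (λ r → +-congˡ (e r)) , λ { (x≈0 ∷ ys≈0) → x≈0 ∷ z ys≈0 }

  ↝⇒≽ : {A B : Vec (Column m) n} → A ↝ B → B ≼ A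
  ↝⇒≽ (addˡ x) (y ∷ z ∷ zs) = y ∷ z + x * y ∷ zs ,
    (λ r → solve 6 (λ x y z c d s → y :* (c :+ x :* d) :+ (z :* d :+ s) :=
                  y :* c :+ ((z :+ x :* y) :* d :+ s)) refl x y z _ _ _) ,
    λ { (y≈0 ∷ z≈0 ∷ zs≈0) →
          y≈0 ∷ trans (sym (drop-zero (trans (*-congˡ y≈0) (zeroʳ _)))) z≈0 ∷ zs≈0 }
  ↝⇒≽ (addʳ x) (y ∷ z ∷ zs) = y + x * z ∷ z ∷ zs ,
    (λ r → solve 6 (λ x y z c d s → y :* c :+ (z :* (d :+ x :* c) :+ s) :=
                  (y :+ x :* z) :* c :+ (z :* d :+ s)) refl x y z _ _ _) ,
    λ { (y≈0 ∷ z≈0 ∷ zs≈0) →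
          trans (sym (drop-zero (trans (*-congˡ z≈0) (zeroʳ _)))) y≈0 ∷ z≈0 ∷ zs≈0 }
  ↝⇒≽ (skip op) (x ∷ xs) with ys , e , z ← ↝⇒≽ op xs =
    x ∷ ys , (λ r → +-congˡ (e r)) , λ { (x≈0 ∷ ys≈0) → x≈0 ∷ z ys≈0 }

  Spanning Independent Dependent : Vec (Column m) n → Set (c ⊔ ℓ)
  Spanning    cs = ∀ (y : Column _) → ∃ λ xs → ∀ r → (cs · xs) r ≈ y r
  Independent cs = ∀ xs → (∀ r → (cs · xs) r ≈ 0#) → Zero xs
  Dependent   cs = ∃ λ xs → (∀ r → (cs · xs) r ≈ 0#) × ¬ Zero xs

  -- The Fredholm alternative in decided form. `Spanning` is carried along for the induction, where
  -- it yields the dependence when the pivot is zero.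
  Alternative : Vec (Column n) n → Set (c ⊔ ℓ)
  Alternative {n} cs =
    (¬ colDet n cs ≈ 0# × Spanning cs × Independent cs) ⊎ (colDet n cs ≈ 0# × Dependent cs)

  alternative-↝ : {A B : Vec (Column n) n} → A ↝ B → Alternative B → Alternative A
  alternative-↝ {n} op (inj₁ (det≉0 , span , indep)) = inj₁
    ( (λ det≈0 → det≉0 (trans (colDet-invariant n op) det≈0))
    , (λ y → let xs , e = span y ; ys , e′ , _ = ↝⇒≽ op xs in ys , λ r → trans (sym (e′ r)) (e r))
    , (λ xs e → let ys , e′ , z = ↝⇒≼ op xs in z (indep ys λ r → trans (sym (e′ r)) (e r))))
  alternative-↝ {n} op (inj₂ (det≈0 , xs , e , xs≉0)) = inj₂
    ( trans (sym (colDet-invariant n op)) det≈0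
    , (let ys , e′ , z = ↝⇒≽ op xs in ys , (λ r → trans (sym (e′ r)) (e r)) , xs≉0 ∘ z))

  -- Gaussian elimination over a field with decidable equality.

  module Elimination (_≟_ : Decidable _≈_) (_⁻¹ : Carrier → Carrier)
    (inverseˡ : ∀ {x} → ¬ x ≈ 0# → x ⁻¹ * x ≈ 1#) (1≉0 : ¬ 1# ≈ 0#) where

    -- Elimination runs from the right: by induction, among the columns after c only their head d
    -- may have a nonzero first entry, and d is then cleared by means of c.
    pivot-induction : ∀ {p} (P : Vec (Column (suc m)) (suc n) → Set p) →
      (∀ {A B} → A ↝ B → P B → P A) →
      (∀ c cs → All (λ d → d zero ≈ 0#) cs → P (c ∷ cs)) → ∀ cs → P cs
    pivot-induction {n = zero}  P back base (c ∷ []) = base c [] []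
    pivot-induction {n = suc n} P back base (c ∷ cs) =
      pivot-induction (λ ds → P (c ∷ ds)) (back ∘ skip) clear cs
      where
      clear : ∀ d ds → All (λ e → e zero ≈ 0#) ds → P (c ∷ d ∷ ds)
      clear d ds zs with d zero ≟ 0#
      ... | yes z = base c (d ∷ ds) (z ∷ zs)
      ... | no d≉0 = back (addˡ x) (back (addʳ y) (base _ _ (pivot ∷ zs)))
        where
        x y : Carrier
        -- Adding x d to c makes its first entry 1 even if it was 0, so no swap of columns is
        -- needed; adding y times the new c to d then clears d.
        x = (1# + - 1# * c zero) * d zero ⁻¹
        y = - 1# * d zero
        one : c zero + x * d zero ≈ 1#
        one = begin
          c zero + x * d zero
            ≈⟨ +-congˡ (trans (*-assoc _ _ _) (trans (*-congˡ (inverseˡ d≉0)) (*-identityʳ _))) ⟩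
          c zero + (1# + - 1# * c zero)
            ≈⟨ solve 2 (λ n c → c :+ (con 1 :+ n :* c) := con 1 :+ (c :+ n :* c)) refl (- 1#) (c zero) ⟩
          1# + (c zero + - 1# * c zero)
            ≈⟨ drop-zero (cancel _) ⟩
          1# ∎
        pivot : d zero + y * (c zero + x * d zero) ≈ 0#
        pivot = trans (+-congˡ (trans (*-congˡ one) (*-identityʳ y))) (cancel _)

    nonzero-* : ∀ {x y} → ¬ x ≈ 0# → x * y ≈ 0# → y ≈ 0#
    nonzero-* {x} {y} x≉0 xy≈0 = begin
      y               ≈⟨ *-identityˡ y ⟨
      1# * y          ≈⟨ *-congʳ (inverseˡ x≉0) ⟨
      x ⁻¹ * x * y    ≈⟨ *-assoc _ _ _ ⟩
      x ⁻¹ * (x * y)  ≈⟨ *-congˡ xy≈0 ⟩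
      x ⁻¹ * 0#       ≈⟨ zeroʳ _ ⟩
      0#              ∎

    -- After elimination the first row is `c zero` followed by zeros. A singular minor gives a
    -- dependence without c. Over a nonsingular minor, a zero pivot gives one with coefficient 1 at
    -- c, because the other columns span the lower rows; a nonzero pivot is inverted and the lower
    -- rows are solved.
    alternative : ∀ n (cs : Vec (Column n) n) → Alternative cs
    alternative zero    [] = inj₁ (1≉0 , (λ y → [] , λ ()) , λ { [] _ → [] })
    alternative (suc n)    = pivot-induction Alternative alternative-↝ base
      where
      base : ∀ c cs → All (λ d → d zero ≈ 0#) cs → Alternative (c ∷ cs)
      base c cs zs with alternative n (map below cs) | c zero ≟ 0#
      ... | inj₂ (det≈0 , xs , e , xs≉0) | _ = inj₂
        ( trans (expand-pivot (colDet n) c cs zs) (trans (*-congˡ det≈0) (zeroʳ _))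
        , 0# ∷ xs
        , (λ { zero    → trans (+-cong (zeroˡ _) (·-zero zs xs)) (+-identityˡ _)
             ; (suc r) → trans (+-cong (zeroˡ _) (trans (reflexive (≡.sym (below-· cs xs r))) (e r)))
                               (+-identityˡ _) })
        , λ { (_ ∷ xs≈0) → xs≉0 xs≈0 } )
      ... | inj₁ (_ , span , _) | yes c≈0 = inj₂
        ( trans (expand-pivot (colDet n) c cs zs) (trans (*-congʳ c≈0) (zeroˡ _))
        , (let xs , e = span (λ r → - 1# * c (suc r)) in
           1# ∷ xs
           , (λ { zero    → trans (+-cong (trans (*-congˡ c≈0) (zeroʳ _)) (·-zero zs xs)) (+-identityˡ _)
                ; (suc r) → trans (+-cong (*-identityˡ _)
                                    (trans (reflexive (≡.sym (below-· cs xs r))) (e r))) (cancel _) })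
           , λ { (1≈0 ∷ _) → 1≉0 1≈0 }))
      ... | inj₁ (det≉0 , span , indep) | no c≉0 = inj₁
        ( (λ det≈0 → det≉0 (nonzero-* c≉0 (trans (sym (expand-pivot (colDet n) c cs zs)) det≈0)))
        , (λ y → let x = c zero ⁻¹ * y zero
                     xs , e = span (λ r → y (suc r) + - 1# * (x * c (suc r))) in
           x ∷ xs
           , λ { zero → begin
                   c zero ⁻¹ * y zero * c zero + (cs · xs) zero ≈⟨ drop-zero (·-zero zs xs) ⟩
                   c zero ⁻¹ * y zero * c zero ≈⟨ solve 3 (λ i y c → i :* y :* c := y :* (i :* c)) refl _ _ _ ⟩
                   y zero * (c zero ⁻¹ * c zero) ≈⟨ *-congˡ (inverseˡ c≉0) ⟩
                   y zero * 1# ≈⟨ *-identityʳ _ ⟩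
                   y zero ∎
               ; (suc r) → begin
                   x * c (suc r) + (cs · xs) (suc r)
                     ≈⟨ +-congˡ (trans (reflexive (≡.sym (below-· cs xs r))) (e r)) ⟩
                   x * c (suc r) + (y (suc r) + - 1# * (x * c (suc r)))
                     ≈⟨ solve 3 (λ s y t → s :+ (y :+ t) := y :+ (s :+ t)) refl _ _ _ ⟩
                   y (suc r) + (x * c (suc r) + - 1# * (x * c (suc r)))
                     ≈⟨ drop-zero (cancel _) ⟩
                   y (suc r) ∎ })
        , λ { (x ∷ xs) e →
                let x≈0 = nonzero-* c≉0 (trans (*-comm _ _) (trans (sym (drop-zero (·-zero zs xs))) (e zero)))
                in x≈0 ∷ indep xs λ r → trans (reflexive (below-· cs xs r))
                     (trans (sym (+-identityˡ _))
                       (trans (+-congʳ (sym (trans (*-congʳ x≈0) (zeroˡ _)))) (e (suc r)))) })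

    nonsingular⇒independent : ∀ n M → ¬ determinant R n M ≈ 0# → Independent (tabulate λ k r → M r k)
    nonsingular⇒independent n M det≉0 with alternative n (tabulate λ k r → M r k)
    ... | inj₁ (_ , _ , indep) = indep
    ... | inj₂ (det≈0 , _)     = contradiction (trans (determinant-columns n M) det≈0) det≉0

    independent⇒nonsingular : ∀ n M → Independent (tabulate λ k r → M r k) → ¬ determinant R n M ≈ 0#
    independent⇒nonsingular n M indep det≈0 with alternative n (tabulate λ k r → M r k)
    ... | inj₁ (det≉0 , _)          = det≉0 (trans (sym (determinant-columns n M)) det≈0)
    ... | inj₂ (_ , xs , e , xs≉0) = xs≉0 (indep xs e)

-- Index arithmetic of Toeplitz matrices.

diagonal : ∀ {m} → Fin (suc m) → Fin (suc m) → ℕ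
diagonal {m} i j = m ℕ.+ toℕ i ∸ toℕ j

diagonal-∸ : ∀ {m} (i j : Fin (suc m)) → diagonal i j ≡ (m ∸ toℕ j) ℕ.+ toℕ i
diagonal-∸ i j = ℕ.+-∸-comm (toℕ i) (ℕ.s≤s⁻¹ (toℕ<n j))

toℕ-opposite : ∀ {m} (i : Fin (suc m)) → toℕ (opposite i) ≡ m ∸ toℕ i
toℕ-opposite = opposite-prop

diagonal-opposite : ∀ {m} (i j : Fin (suc m)) → diagonal (opposite i) (opposite j) ≡ diagonal j i
diagonal-opposite {m} i j = begin
  diagonal (opposite i) (opposite j)                 ≡⟨ diagonal-∸ (opposite i) (opposite j) ⟩
  (m ∸ toℕ (opposite j)) ℕ.+ toℕ (opposite i)        ≡⟨ ≡.cong₂ (λ s t → (m ∸ s) ℕ.+ t) (toℕ-opposite j) (toℕ-opposite i) ⟩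
  (m ∸ (m ∸ toℕ j)) ℕ.+ (m ∸ toℕ i)                  ≡⟨ ≡.cong (ℕ._+ (m ∸ toℕ i)) (ℕ.m∸[m∸n]≡n (ℕ.s≤s⁻¹ (toℕ<n j))) ⟩
  toℕ j ℕ.+ (m ∸ toℕ i)                              ≡⟨ ℕ.+-comm (toℕ j) _ ⟩
  (m ∸ toℕ i) ℕ.+ toℕ j                              ≡⟨ diagonal-∸ j i ⟨
  diagonal j i                                       ∎
  where open ≡.≡-Reasoning

-- The indices at transposed positions add up to m + m, the last index of the word, so reading the
-- word backwards transposes the matrix.
diagonal-flip : ∀ {m} (i j : Fin (suc m)) → m ℕ.+ m ∸ diagonal i j ≡ diagonal j i
diagonal-flip {m} i j = begin
  m ℕ.+ m ∸ diagonal i j                            ≡⟨ ≡.cong (_∸ diagonal i j) total ⟨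
  (diagonal j i ℕ.+ diagonal i j) ∸ diagonal i j    ≡⟨ ℕ.m+n∸n≡m (diagonal j i) (diagonal i j) ⟩
  diagonal j i                                      ∎
  where
  open ≡.≡-Reasoning
  open +-*-Solver
  total : diagonal j i ℕ.+ diagonal i j ≡ m ℕ.+ m
  total = begin
    diagonal j i ℕ.+ diagonal i j
      ≡⟨ ≡.cong₂ ℕ._+_ (diagonal-∸ j i) (diagonal-∸ i j) ⟩
    ((m ∸ toℕ i) ℕ.+ toℕ j) ℕ.+ ((m ∸ toℕ j) ℕ.+ toℕ i)
      ≡⟨ solve 4 (λ a b c d → (a :+ b) :+ (c :+ d) := (a :+ d) :+ (c :+ b)) ≡.refl
           (m ∸ toℕ i) (toℕ j) (m ∸ toℕ j) (toℕ i) ⟩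
    ((m ∸ toℕ i) ℕ.+ toℕ i) ℕ.+ ((m ∸ toℕ j) ℕ.+ toℕ j)
      ≡⟨ ≡.cong₂ ℕ._+_ (ℕ.m∸n+n≡m (ℕ.s≤s⁻¹ (toℕ<n i))) (ℕ.m∸n+n≡m (ℕ.s≤s⁻¹ (toℕ<n j))) ⟩
    m ℕ.+ m ∎

-- Words as series: fusion, Toeplitz matrices and reversal.

module Words {c ℓ} (R : CommutativeRing c ℓ) where
  open CommutativeRing R hiding (zero)
  open Sequences setoid
  open PowerSeries R
  open VecEquality setoid
  open SemiringSum semiring using (sum; sum-cong-≋; ∑-permute)

  private variable
    k l m n s : ℕ

  series : Vec Carrier n → Seq
  series []       = 𝟘
  series (x ∷ xs) = cons x (series xs)

  word : ∀ n → Seq → Vec Carrier n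
  word n h = tabulate {n = n} (h ∘ toℕ)

  series-cong : {xs : Vec Carrier m} {ys : Vec Carrier n} → xs ≋ ys → ∀ i → series xs i ≈ series ys i
  series-cong []      i       = refl
  series-cong (x ∷ e) zero    = x
  series-cong (x ∷ e) (suc i) = series-cong e i

  series-≥ : ∀ (xs : Vec Carrier n) {i} → n ≤ i → series xs i ≡ 0#
  series-≥ []       _           = ≡.refl
  series-≥ (x ∷ xs) (s≤s n≤i) = series-≥ xs n≤i

  series-tabulate : ∀ (v : Fin n → Carrier) i → series (tabulate v) (toℕ i) ≡ v i
  series-tabulate v zero    = ≡.refl
  series-tabulate v (suc i) = series-tabulate (v ∘ suc) i

  series-word : ∀ n h → series (word n h) ≈[ n ] h
  series-word (suc n) h zero    _        = refl
  series-word (suc n) h (suc i) (s≤s i<) = series-word n (tail h) i i<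

  word-cong : ∀ {g h} → g ≈[ n ] h → word n g ≋ word n h
  word-cong {zero}  e = []
  word-cong {suc n} e = e 0 (s≤s z≤n) ∷ word-cong λ i i< → e (suc i) (s≤s i<)

  word-series : m ≡ n → (xs : Vec Carrier m) → word n (series xs) ≋ xs
  word-series ≡.refl []       = []
  word-series ≡.refl (x ∷ xs) = refl ∷ word-series ≡.refl xs

  lookup-series : ∀ (xs : Vec Carrier n) {i} .(i<n : i < n) → lookup xs (fromℕ< i<n) ≡ series xs i
  lookup-series (x ∷ xs) {zero}  _   = ≡.refl
  lookup-series (x ∷ xs) {suc i} i<n = lookup-series xs (ℕ.s<s⁻¹ i<n)

  series-++ˡ : ∀ (xs : Vec Carrier m) (ys : Vec Carrier n) {i} → i < m → series (xs ++ ys) i ≡ series xs i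
  series-++ˡ (x ∷ xs) ys {zero}  _        = ≡.refl
  series-++ˡ (x ∷ xs) ys {suc i} (s≤s i<) = series-++ˡ xs ys i<

  series-++ʳ : ∀ (xs : Vec Carrier m) (ys : Vec Carrier n) i → series (xs ++ ys) (m ℕ.+ i) ≡ series ys i
  series-++ʳ []       ys i = ≡.refl
  series-++ʳ (x ∷ xs) ys i = series-++ʳ xs ys i

  word-split : ∀ m n (xs : Vec Carrier k) → k ≡ m ℕ.+ n →
               xs ≋ word m (series xs) ++ word n (λ i → series xs (m ℕ.+ i))
  word-split zero    n xs       eq     = ≋-sym (word-series eq xs)
  word-split (suc m) n (x ∷ xs) ≡.refl = refl ∷ word-split m n xs ≡.refl

  fusion⇒overlap : {u : Vec Carrier m} {v : Vec Carrier n} {z : Vec Carrier l} → m ≡ k ℕ.+ s →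
    Fusion setoid s u v z → (λ i → series u (k ℕ.+ i)) ≈[ s ] series v
  fusion⇒overlap {k = k} {s} {u} {v} m≡ (x , k′ , u₀ , _ , v₀ , u≋ , v≋ , _) i i<s = begin
    series u (k ℕ.+ i)           ≡⟨ ≡.cong (λ k → series u (k ℕ.+ i)) k≡k′ ⟩
    series u (k′ ℕ.+ i)          ≈⟨ series-cong u≋ (k′ ℕ.+ i) ⟩
    series (u₀ ++ x) (k′ ℕ.+ i)  ≡⟨ series-++ʳ u₀ x i ⟩
    series x i                   ≡⟨ series-++ˡ x v₀ i<s ⟨
    series (x ++ v₀) i           ≈⟨ series-cong v≋ i ⟨
    series v i                   ∎
    where
    open SetoidReasoning setoid
    k≡k′ : k ≡ k′
    -- Equal vectors have equal lengths, which determines the length of u₀.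
    k≡k′ = ℕ.+-cancelʳ-≡ s k k′ (≡.trans (≡.sym m≡) (length-equal u≋))

  overlap⇒fusion : (u : Vec Carrier m) (v : Vec Carrier n) → m ≡ k ℕ.+ s → n ≡ s ℕ.+ l →
    ∀ p → k ℕ.+ (s ℕ.+ l) ≡ p → (λ i → series u (k ℕ.+ i)) ≈[ s ] series v →
    ∃ λ (z : Vec Carrier p) → Fusion setoid s u v z
  overlap⇒fusion {k = k} {s} {l} u v m≡ n≡ p p≡ e =
    word p (series (u₀ ++ (x ++ v₀))) , x , k , u₀ , l , v₀ ,
    ≋-trans (word-split k s u m≡) (++⁺ (≋-refl {x = u₀}) (word-cong e)) ,
    word-split s l v n≡ , word-series p≡ _
    where
    x : Vec Carrier s
    x  = word s (series v)
    u₀ : Vec Carrier k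
    u₀ = word k (series u)
    v₀ : Vec Carrier l
    v₀ = word l λ i → series v (s ℕ.+ i)

  -- By m ≤ k + 1 every j < m is at most k, so `k ∸ toℕ j` is a true difference; the terms from m on
  -- vanish by the degree bound.
  ⊛-sum : ∀ m {p h} → (∀ i → m ≤ i → p i ≈ 0#) → ∀ {k} → m ≤ suc k →
          (p ⊛ h) k ≈ sum {m} (λ j → p (toℕ j) * h (k ∸ toℕ j))
  ⊛-sum zero {p} {h} deg {k} _ =
    trans (⊛-cong {suc k} {p} {𝟘} {h} (λ i _ → deg i z≤n) (λ _ _ → refl) k ℕ.≤-refl) (⊛-zeroˡ h k)
  ⊛-sum (suc zero)    deg {zero}  _        = sym (+-identityʳ _)
  ⊛-sum (suc (suc _)) deg {zero}  (s≤s ())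
  ⊛-sum (suc m)       deg {suc k} (s≤s m≤) =
    +-congˡ (⊛-sum m (λ i m≤i → deg (suc i) (s≤s m≤i)) m≤)

  -- The kernel condition for m + 1 and m in matrix form: v holds the coefficients of p, and row i
  -- is the coefficient m + i of p h.
  Nondegenerate : ∀ m → Seq → Set (c ⊔ ℓ)
  Nondegenerate m h = ∀ (v : Fin (suc m) → Carrier) → (∀ i → sum (λ j → v j * h (diagonal i j)) ≈ 0#) → ∀ j → v j ≈ 0#

  private
    row-bounds : ∀ {m} (i : Fin (suc m)) → m ≤ m ℕ.+ toℕ i × m ℕ.+ toℕ i < suc m ℕ.+ m
    row-bounds {m} i = ℕ.m≤m+n m (toℕ i) ,
      s≤s (ℕ.+-monoʳ-≤ m (ℕ.s≤s⁻¹ (toℕ<n i)))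

  kernel⇒nondegenerate : ∀ m {h} → TrivialKernel (suc m) m h → Nondegenerate m h
  kernel⇒nondegenerate m {h} K v ann j =
    trans (reflexive (≡.sym (series-tabulate v j))) (K p deg coefficients (toℕ j))
    where
    p : Seq
    p = series (tabulate v)
    deg : ∀ i → suc m ≤ i → p i ≈ 0#
    deg i m<i = reflexive (series-≥ (tabulate v) m<i)
    coefficients : ∀ i → m ≤ i → i < suc m ℕ.+ m → (p ⊛ h) i ≈ 0#
    coefficients i m≤i i< = begin
      (p ⊛ h) i
        ≈⟨ ⊛-sum (suc m) deg (s≤s m≤i) ⟩
      sum {suc m} (λ j → p (toℕ j) * h (i ∸ toℕ j))
        ≈⟨ sum-cong-≋ {suc m} (λ j → *-cong (reflexive (series-tabulate v j))
             (reflexive (≡.cong (λ i → h (i ∸ toℕ j)) (≡.sym row)))) ⟩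
      sum {suc m} (λ j → v j * h (diagonal r j))
        ≈⟨ ann r ⟩
      0# ∎
      where
      open SetoidReasoning setoid
      i∸m< : i ∸ m < suc m
      i∸m< = ℕ.<-≤-trans (ℕ.∸-monoˡ-< i< m≤i) (ℕ.≤-reflexive (ℕ.m+n∸n≡m (suc m) m))
      r : Fin (suc m)
      r = fromℕ< i∸m<
      row : m ℕ.+ toℕ r ≡ i
      row = ≡.trans (≡.cong (m ℕ.+_) (toℕ-fromℕ< i∸m<)) (ℕ.m+[n∸m]≡n m≤i)

  nondegenerate⇒kernel : ∀ m {h} → Nondegenerate m h → TrivialKernel (suc m) m h
  nondegenerate⇒kernel m {h} N p deg ann i with i <? suc m
  ... | no i≮  = deg i (ℕ.≮⇒≥ i≮)
  ... | yes i< = trans (reflexive (≡.cong p (≡.sym (toℕ-fromℕ< i<))))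
    (N (p ∘ toℕ) (λ r → let ≤r , r< = row-bounds r in
       trans (sym (⊛-sum (suc m) deg (s≤s ≤r))) (ann (m ℕ.+ toℕ r) ≤r r<)) (fromℕ< i<))

  reversed : ℕ → Seq → Seq
  reversed m h i = h (m ℕ.+ m ∸ i)

  private
    -- Reversing the order of its entries turns a kernel vector for h into one for g; permuting the
    -- summands matches row i with row `opposite i`.
    nondegenerate-opposite : ∀ m {g h} →
      (∀ i j → g (diagonal {m} i j) ≡ h (diagonal (opposite i) (opposite j))) →
      Nondegenerate m g → Nondegenerate m h
    nondegenerate-opposite m {g} {h} e N v ann j =
      trans (reflexive (≡.cong v (≡.sym (opposite-involutive j))))
            (N (v ∘ opposite) row (opposite j))
      where
      open SetoidReasoning setoid
      row : ∀ i → sum (λ j → v (opposite j) * g (diagonal i j)) ≈ 0#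
      row i = begin
        sum (λ j → v (opposite j) * g (diagonal i j))
          ≈⟨ sum-cong-≋ {suc m} (λ j → *-congˡ {v (opposite j)} (reflexive (e i j))) ⟩
        sum (λ j → v (opposite j) * h (diagonal (opposite i) (opposite j)))
          ≈⟨ ∑-permute (λ j → v j * h (diagonal (opposite i) j)) Permutation.reverse ⟨
        sum (λ j → v j * h (diagonal (opposite i) j))
          ≈⟨ ann (opposite i) ⟩
        0# ∎

  -- Reversing a word transposes its Toeplitz matrix, which amounts to
  -- conjugating it by the antidiagonal permutation.
  nondegenerate-reversed : ∀ m h → Nondegenerate m h → Nondegenerate m (reversed m h)
  nondegenerate-reversed m h = nondegenerate-opposite m {h} {reversed m h} λ i j → ≡.cong h (≡.sym
    (≡.trans (diagonal-flip (opposite i) (opposite j)) (diagonal-opposite j i)))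

  reversed-nondegenerate : ∀ m h → Nondegenerate m (reversed m h) → Nondegenerate m h
  reversed-nondegenerate m h = nondegenerate-opposite m {reversed m h} {h} λ i j → ≡.cong h
    (≡.trans (diagonal-flip i j) (≡.sym (diagonal-opposite i j)))

  module _ {m : ℕ} (a : Vec Carrier (2 ℕ.* suc m ∸ 1)) where
    open Columns R using (Column; _·_; Independent)

    private
      columns : Vec (Column (suc m)) (suc m)
      columns = tabulate λ k r → toeplitz (suc m) a r k

      ·-sum : ∀ {k} (M : Fin k → Column n) xs r → (tabulate M · xs) r ≡ sum (λ j → lookup xs j * M j r)
      ·-sum {k = zero}  M []       r = ≡.refl
      ·-sum {k = suc k} M (x ∷ xs) r = ≡.cong (x * M zero r +_) (·-sum (M ∘ suc) xs r)

      -- `toeplitz` has the index `diagonal j r` in row r and column j, transposed against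
      -- `Nondegenerate`; reversing the word makes up for this.
      columns-· : ∀ xs r → (columns · xs) r ≈ sum (λ j → lookup xs j * reversed m (series a) (diagonal r j))
      columns-· xs r = trans (reflexive (·-sum (λ k r → toeplitz (suc m) a r k) xs r))
        (sum-cong-≋ {suc m} λ j → *-congˡ {lookup xs j} (reflexive
          (≡.trans (lookup-series a {diagonal j r} (toeplitz-bound (suc m) r j))
                   (≡.cong (series a) {diagonal j r} {m ℕ.+ m ∸ diagonal r j} (≡.sym (diagonal-flip r j))))))

    independent⇒nondegenerate : Independent columns → Nondegenerate m (reversed m (series a))
    independent⇒nondegenerate indep v ann j = trans
      (reflexive (≡.sym (lookup∘tabulate v j)))
      (All.lookup⁺ (indep (tabulate v) λ r → trans (columns-· (tabulate v) r)
        (trans (sum-cong-≋ {suc m} λ j → *-congʳ {reversed m (series a) (diagonal r j)}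
          (reflexive (lookup∘tabulate v j))) (ann r))) j)

    nondegenerate⇒independent : Nondegenerate m (reversed m (series a)) → Independent columns
    nondegenerate⇒independent N xs e =
      All.lookup⁻ (N (lookup xs) λ r → trans (sym (columns-· xs r)) (e r))

-- Degrees in the de Bruijn graph, with b = m + 1.

module _ {c ℓ} (R : CommutativeRing c ℓ) where
  open CommutativeRing R hiding (zero)

  module DeBruijn (_⁻¹ : Carrier → Carrier) (inverseˡ : ∀ {x} → ¬ x ≈ 0# → x ⁻¹ * x ≈ 1#)
    (1≉0 : ¬ 1# ≈ 0#) {q : ℕ} (I : HasSize setoid q) (m : ℕ) where

    open Sequences setoid
    open PowerSeries R
    open Words R
    open VecEquality setoid
    open Counting R _⁻¹ inverseˡ 1≉0 I
    open Columns R using (module Elimination)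
    open Elimination (Enum.≈-dec I) _⁻¹ inverseˡ 1≉0
    open Digraph (G-det R (suc m)) using (Vertex; Edge; HasOutdegree; HasIndegree)

    private
      N : ℕ
      N = 2 ℕ.* suc m ∸ 1

      N≡ : N ≡ suc m ℕ.+ m
      N≡ = ≡.trans (ℕ.+-suc m (m ℕ.+ 0)) (≡.cong (λ k → suc (m ℕ.+ k)) (ℕ.+-identityʳ m))

    nonsingular⇒kernel : ∀ a → ¬ det R (suc m) a ≈ 0# → TrivialKernel (suc m) m (series a)
    nonsingular⇒kernel a det≉0 = nondegenerate⇒kernel m (reversed-nondegenerate m (series a)
      (independent⇒nondegenerate a (nonsingular⇒independent (suc m) (toeplitz (suc m) a) det≉0)))

    kernel⇒nonsingular : ∀ a → TrivialKernel (suc m) m (series a) → ¬ det R (suc m) a ≈ 0#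
    kernel⇒nonsingular a K = independent⇒nonsingular (suc m) (toeplitz (suc m) a)
      (nondegenerate⇒independent a (nondegenerate-reversed m (series a) (kernel⇒nondegenerate m K)))

    kernel-reversed : ∀ {h} → TrivialKernel (suc m) m h → TrivialKernel (suc m) m (reversed m h)
    kernel-reversed {h} = nondegenerate⇒kernel m ∘ nondegenerate-reversed m h ∘ kernel⇒nondegenerate m

    word-vertex : ∀ h → TrivialKernel (suc m) m h → Vertex
    word-vertex h K = word N h , kernel⇒nonsingular (word N h)
      (kernel-cong (suc m) m
        (λ i i< → sym (series-word N h i (ℕ.<-≤-trans i< (ℕ.≤-reflexive (≡.sym N≡))))) K)

    Overlap : Vertex → Vertex → Set ℓ
    Overlap (u , _) (v , _) = (λ i → series u (suc m ℕ.+ i)) ≈[ m ] series v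

    edge⇒overlap : ∀ u v → Edge u v → Overlap u v
    edge⇒overlap u v (z , fusion) = fusion⇒overlap N≡ fusion

    overlap⇒edge : ∀ u v → Overlap u v → Edge u v
    overlap⇒edge (u , _) (v , _) =
      overlap⇒fusion u v N≡ (≡.trans N≡ (ℕ.+-comm (suc m) m)) (3 ℕ.* suc m ∸ 1)
        (solve 1 (λ m → con 1 :+ m :+ (m :+ (con 1 :+ m)) :=
                        m :+ (con 1 :+ (m :+ (con 1 :+ (m :+ con 0))))) ≡.refl m)
      where open +-*-Solver

    -- Out-neighbours are the nonsingular words whose first m letters are the last m letters of v,
    -- that is, the solutions for n = m with this prefix.
    outdegree : ∀ v → HasOutdegree v ((q ∸ 1) ℕ.* q ^ m)
    outdegree v = transfer
      (λ (h , e , K) → word-vertex h K , overlap⇒edge v (word-vertex h K)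
         λ i i< → trans (sym (e i i<)) (sym (series-word N h i (short i<))))
      (λ ((w , det≉0) , edge) → series w ,
         (λ i i< → sym (edge⇒overlap v (w , det≉0) edge i i<)) , nonsingular⇒kernel w det≉0)
      (λ e → word-cong λ i i< → e i (ℕ.<-≤-trans i< (ℕ.≤-reflexive N≡)))
      (λ e i _ → series-cong e i)
      (λ ((w , _) , _) → word-series ≡.refl w)
      (λ (h , _) i i< → series-word N h i (ℕ.<-≤-trans i< (ℕ.≤-reflexive (≡.sym N≡))))
      (solutions-size m m (λ i → series (proj₁ v) (suc m ℕ.+ i)))
      where
      short : ∀ {i} → i < m → i < N
      short i<m = ℕ.<-≤-trans i<m (ℕ.m≤m+n m _)

    -- The reversal of an in-neighbour begins with the first m letters of v in reverse order and
    -- still has a trivial kernel, so the same count applies.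
    indegree : ∀ v → HasIndegree v ((q ∸ 1) ℕ.* q ^ m)
    indegree v = transfer
      (λ (h , e , K) → let w = word-vertex (reversed m h) (kernel-reversed K) in
         w , overlap⇒edge w v λ i i< → begin
           series (word N (reversed m h)) (suc m ℕ.+ i)
             ≈⟨ series-word N (reversed m h) (suc m ℕ.+ i)
                  (ℕ.<-≤-trans (ℕ.+-monoʳ-< (suc m) i<) (ℕ.≤-reflexive (≡.sym N≡))) ⟩
           h (m ℕ.+ m ∸ (suc m ℕ.+ i))  ≡⟨ ≡.cong h (tail-index i) ⟩
           h (m ∸ suc i)                ≈⟨ e (m ∸ suc i) (mirror< i<) ⟩
           prefix (m ∸ suc i)           ≡⟨ ≡.cong (series (proj₁ v)) (mirror i<) ⟩
           series (proj₁ v) i           ∎)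
      (λ ((w , det≉0) , edge) → reversed m (series w) ,
         (λ i i< → begin
            series w (m ℕ.+ m ∸ i)               ≡⟨ ≡.cong (series w) (head-index i<) ⟩
            series w (suc m ℕ.+ (m ∸ suc i))     ≈⟨ edge⇒overlap (w , det≉0) v edge (m ∸ suc i) (mirror< i<) ⟩
            prefix i                             ∎) ,
         kernel-reversed (nonsingular⇒kernel w det≉0))
      (λ e → word-cong λ i _ → e (m ℕ.+ m ∸ i) (s≤s (ℕ.m∸n≤m (m ℕ.+ m) i)))
      (λ e i _ → series-cong e (m ℕ.+ m ∸ i))
      (λ ((w , _) , _) → ≋-trans
         (word-cong λ i i< → reflexive (≡.cong (series w)
           (ℕ.m∸[m∸n]≡n (ℕ.s≤s⁻¹ (ℕ.<-≤-trans i< (ℕ.≤-reflexive N≡))))))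
         (word-series ≡.refl w))
      (λ (h , _) i i< → trans
         (series-word N (reversed m h) (m ℕ.+ m ∸ i)
           (ℕ.<-≤-trans (s≤s (ℕ.m∸n≤m (m ℕ.+ m) i)) (ℕ.≤-reflexive (≡.sym N≡))))
         (reflexive (≡.cong h (ℕ.m∸[m∸n]≡n (ℕ.s≤s⁻¹ i<)))))
      (solutions-size m m prefix)
      where
      open SetoidReasoning setoid
      prefix : Seq
      prefix i = series (proj₁ v) (m ∸ suc i)
      mirror< : ∀ {i} → i < m → m ∸ suc i < m
      mirror< i<m = ℕ.∸-monoʳ-< (s≤s z≤n) i<m
      mirror : ∀ {i} → i < m → m ∸ suc (m ∸ suc i) ≡ i
      mirror {i} i<m = ≡.trans (≡.sym (ℕ.pred[m∸n]≡m∸[1+n] m (m ∸ suc i))) (≡.cong ℕ.pred (ℕ.m∸[m∸n]≡n i<m))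
      tail-index : ∀ i → m ℕ.+ m ∸ (suc m ℕ.+ i) ≡ m ∸ suc i
      tail-index i = ≡.trans (≡.cong (m ℕ.+ m ∸_) (≡.sym (ℕ.+-suc m i))) (ℕ.[m+n]∸[m+o]≡n∸o m m (suc i))
      head-index : ∀ {i} → i < m → m ℕ.+ m ∸ i ≡ suc m ℕ.+ (m ∸ suc i)
      head-index {i} i<m = ≡.trans (ℕ.+-∸-assoc m (ℕ.<⇒≤ i<m))
        (≡.trans (≡.cong (m ℕ.+_) (ℕ.+-∸-assoc 1 i<m)) (ℕ.+-suc m (m ∸ suc i)))

-- Inverses in a finite Heyting field.

module _ {c ℓ₁ ℓ₂} (F : HeytingField c ℓ₁ ℓ₂) where
  open HeytingField F hiding (zero)

  -- If 1 = 0, then 0 - 0 is invertible and 0 is apart from itself.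
  1≉0 : ¬ 1# ≈ 0#
  1≉0 1≈0 = #-irrefl refl (invertible⇒# {0#} {0#}
    (0# , trans (zeroˡ _) (sym 1≈0) , trans (zeroʳ _) (sym 1≈0)))

  module _ {q : ℕ} (I : HasSize (CommutativeRing.setoid (fieldRing F)) q) where
    open Enum I using (elt; idx; elt-idx) renaming (≈-dec to infix 4 _≟_)

    infix 8 _⁻¹
    -- The inverse is searched for in the enumeration, as x ≠ 0 does not directly provide an
    -- apartness; 0 is the default value.
    _⁻¹ : Carrier → Carrier
    x ⁻¹ with any? (λ i → elt i * x ≟ 1#)
    ... | yes (i , _) = elt i
    ... | no _        = 0#

    -- If the search fails, x is not apart from 0, since apartness would supply an inverse; by
    -- tightness x = 0.
    ⁻¹-inverseˡ : ∀ {x} → ¬ x ≈ 0# → x ⁻¹ * x ≈ 1#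
    ⁻¹-inverseˡ {x} x≉0 with any? (λ i → elt i * x ≟ 1#)
    ... | yes (_ , e)  = e
    ... | no noInverse = contradiction (proj₁ (tight x 0#) unapart) x≉0
      where
      unapart : ¬ x # 0#
      unapart x#0 with y , y*x , _ ← #⇒invertible x#0 = noInverse (idx y , (begin
        elt (idx y) * x  ≈⟨ *-congʳ (elt-idx y) ⟩
        y * x            ≈⟨ *-congˡ (+-identityʳ x) ⟨
        y * (x + 0#)     ≈⟨ *-congˡ (+-congˡ -0≈0) ⟨
        y * (x - 0#)     ≈⟨ y*x ⟩
        1#               ∎))
        where
        open SetoidReasoning (CommutativeRing.setoid (fieldRing F))
        -0≈0 : - 0# ≈ 0#
        -0≈0 = trans (sym (+-identityˡ _)) (-‿inverseʳ 0#)

open import Data.Nat.Base using (_*_)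

lemma3 : ∀ {c ℓ₁ ℓ₂} (q : ℕ) → IsPrimePower q →
    (F : HeytingField c ℓ₁ ℓ₂) →
    HasSize (CommutativeRing.setoid (fieldRing F)) q →
    (b : ℕ) → 2 ≤ b →
    Digraph.Regular (G-det (fieldRing F) b) ((q ∸ 1) * q ^ (b ∸ 1))
lemma3 q _ F I (suc m) _ v = indegree v , outdegree v
  where open DeBruijn (fieldRing F) (_⁻¹ F I) (⁻¹-inverseˡ F I) (1≉0 F) I m
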